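{- Let $M$ be an algebraic number field of degree $m$ with ring of integers $\mathbb{Z}_M$ and integral basis $(1,\omega_2,\ldots,\omega_m)$. Let $\alpha$ be an algebraic integer over $M$ of degree $n$ over $M$, let $K=M(\alpha)$, and let $0\neq\mu\in\mathbb{Z}_M$. Let $S$ be the $m\times m$ matrix whose $j$-th row is $(1,\omega_2^{(j)},\ldots,\omega_m^{(j)})$, let $c_2$ be the row norm of $S^{ -1}$ (the maximum over the rows of $S^{ -1}$ of the sum of the absolute values of the entries of that row), and set \[ c_3=\frac{\sqrt[n]{\overline{|\mu|}}}{\overline{|\alpha|}},\qquad c_5=2c_2\,\overline{|\alpha|}. \] Suppose $X,Y\in\mathbb{Z}_M$ satisfy \[ N_{K/M}(X-\alpha Y)=\mu \] and $\overline{|Y|}>c_3$. Write $X=x_1+\omega_2x_2+\cdots+\omega_mx_m$ and $Y=y_1+\omega_2y_2+\cdots+\omega_my_m$ with $x_i,y_i\in\mathbb{Z}$, and put $A=\max(\max_i|x_i|,\max_i|y_i|)$. Then \[ A\le c_5\cdot\overline{|Y|}. \]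
   Context: Let $\sigma_1,\ldots,\sigma_m$ be the embeddings of $M$ into $\mathbb{C}$; for $\gamma\in M$ write $\gamma^{(j)}=\sigma_j(\gamma)$. Let $f(x)\in\mathbb{Z}_M[x]$ be the monic relative defining polynomial of $\alpha$ over $M$, and for $j=1,\ldots,m$ let $\alpha^{(j1)},\ldots,\alpha^{(jn)}$ be the roots of the polynomial obtained by applying $\sigma_j$ to the coefficients of $f$ (the relative conjugates of $\alpha$ over $M^{(j)}$). For an algebraic number $\gamma$, its size $\overline{|\gamma|}$ is the maximum of the absolute values of its conjugates; in particular $\overline{|\alpha|}=\max_{j,k}|\alpha^{(jk)}|$, $\overline{|Y|}=\max_j|Y^{(j)}|$, $\overline{|\mu|}=\max_j|\mu^{(j)}|$. -}

module Defs where

open import Algebra.Apartness.Bundles using (HeytingField)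
open import Algebra.Apartness.Structures using (IsHeytingField)
open import Algebra.Bundles using (CommutativeRing; RawRing)
open import Algebra.Core using (Op₁; Op₂)
open import Algebra.Morphism.Structures using (IsRingHomomorphism)
import Algebra.Construct.NaturalChoice.Max as Max
import Algebra.Definitions.RawSemiring as RawSemiringOps
import Algebra.Properties.Ring as RingProperties
import Algebra.Properties.Semiring.Sum as SemiringSum
open import Data.Bool.Base using (if_then_else_)
open import Data.Fin.Base using (Fin; zero; suc; toℕ; fromℕ; inject₁; punchIn)
open import Data.Fin.Properties using (toℕ-inject₁; toℕ-fromℕ) renaming (_≟_ to _≟ᶠ_)
open import Data.Integer.Base as ℤ using (ℤ; +_; -[1+_])
open import Data.Nat.Base as ℕ using (ℕ; zero; suc)
import Data.Rational.Base as ℚ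
open import Data.Product.Base using (∃; ∃₂; _×_; _,_; proj₁; proj₂)
open import Data.Sum.Base using (_⊎_; inj₁; inj₂)
open import Data.Vec.Functional as Vector using (Vector)
open import Function.Base using (_∘_)
open import Level using (Level; 0ℓ) renaming (suc to lsuc; _⊔_ to _⊔ˡ_)
open import Relation.Binary.Bundles using (DecTotalOrder)
open import Relation.Binary.Core using (Rel)
import Relation.Binary.Construct.NonStrictToStrict as ToStrict
open import Relation.Binary.PropositionalEquality.Core as ≡ using (_≡_)
import Relation.Binary.Reasoning.Setoid as SetoidReasoning
open import Relation.Binary.Structures using (IsDecTotalOrder)
open import Relation.Nullary using (¬_; does; yes; no)
open import Relation.Unary using (Pred)

private
  variable
    a b c ℓ ℓ₁ ℓ₂ c′ ℓ₁′ ℓ₂′ : Level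
    m n : ℕ

Matrix : Set a → ℕ → ℕ → Set a
Matrix A m n = Fin m → Fin n → A

module RingOps (A : RawRing c ℓ) where
  open RawRing A
  open RawSemiringOps rawSemiring public using (sum; product; _^_) renaming (_×_ to _·_)

  fromℤ : ℤ → Carrier
  fromℤ (+ k)    = k · 1#
  fromℤ -[1+ k ] = - (suc k · 1#)

  -- c₀ + c₁ x + ⋯ + cₙ₋₁ xⁿ⁻¹
  poly : Vector Carrier n → Carrier → Carrier
  poly c x = sum (λ i → c i * x ^ toℕ i)

  -- c₀ + c₁ x + ⋯ + cₙ₋₁ xⁿ⁻¹ + xⁿ
  monic : Vector Carrier n → Carrier → Carrier
  monic {n} c x = poly c x + x ^ n

  IsIntegral : Carrier → Set ℓ
  IsIntegral x = ∃₂ λ d (c : Vector ℤ d) → monic (fromℤ ∘ c) x ≈ 0#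

  det : Matrix Carrier n n → Carrier
  det {zero}  A = 1#
  det {suc n} A =
    sum (λ j → (- 1#) ^ toℕ j * (A zero j * det (λ i k → A (suc i) (punchIn j k))))

  1ᴹ : Matrix Carrier n n
  1ᴹ i j = if does (i ≟ᶠ j) then 1# else 0#

  _*ᴹ_ : ∀ {k} → Matrix Carrier m k → Matrix Carrier k n → Matrix Carrier m n
  (A *ᴹ B) i j = sum (λ k → A i k * B k j)

  IsInverse : Matrix Carrier n n → Matrix Carrier n n → Set ℓ
  IsInverse A B = (∀ i j → (A *ᴹ B) i j ≈ 1ᴹ i j) × (∀ i j → (B *ᴹ A) i j ≈ 1ᴹ i j)

record Basis {F : RawRing a ℓ₁} {E : RawRing b ℓ₂}
             (ι : RawRing.Carrier F → RawRing.Carrier E) (n : ℕ) : Set (a ⊔ˡ b ⊔ˡ ℓ₁ ⊔ˡ ℓ₂) where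
  private
    module F = RawRing F
    module E = RawRing E
  open RingOps E using (sum)
  field
    vec         : Vector E.Carrier n
    coord       : E.Carrier → Vector F.Carrier n
    expand      : ∀ β → β E.≈ sum (λ i → ι (coord β i) E.* vec i)
    independent : ∀ (c : Vector F.Carrier n) →
                  sum (λ i → ι (c i) E.* vec i) E.≈ E.0# → ∀ i → c i F.≈ F.0#

  multMatrix : E.Carrier → Matrix F.Carrier n n
  multMatrix β i j = coord (β E.* vec j) i

  -- Defined from a basis; up to ≈ it does not depend on the choice.
  norm : E.Carrier → F.Carrier
  norm β = RingOps.det F (multMatrix β)

-- The apartness of a HeytingField is "the difference is invertible"; being tight and
-- irreflexive, it is classically the negation of ≈, and it forces 0# ≉ 1#.
commutativeRingOf : HeytingField c ℓ₁ ℓ₂ → CommutativeRing c ℓ₁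
commutativeRingOf F = record { isCommutativeRing = HeytingField.isCommutativeRing F }

record NumberField c ℓ₁ ℓ₂ (m : ℕ) : Set (lsuc (c ⊔ˡ ℓ₁ ⊔ˡ ℓ₂)) where
  field
    heytingField : HeytingField c ℓ₁ ℓ₂
  open CommutativeRing (commutativeRingOf heytingField) public hiding (zero)
  open RingOps rawRing public
  field
    fromℚ      : ℚ.ℚ → Carrier
    fromℚ-homo : IsRingHomomorphism ℚ.+-*-rawRing rawRing fromℚ
    basis      : Basis {F = ℚ.+-*-rawRing} {E = rawRing} fromℚ m

record IntegralBasis (M : NumberField c ℓ₁ ℓ₂ m) : Set (c ⊔ˡ ℓ₁) where
  open NumberField M

  field
    ω : Vector Carrier m

  combination : Vector ℤ m → Carrier
  combination x = sum (λ i → fromℤ (x i) * ω i)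

  field
    ω-first       : ∀ i → toℕ i ≡ 0 → ω i ≈ 1#
    ω-integral    : ∀ i → IsIntegral (ω i)
    ω-spans       : ∀ γ → IsIntegral γ → ∃ λ x → γ ≈ combination x
    ω-independent : ∀ x → combination x ≈ 0# → ∀ i → x i ≡ ℤ.0ℤ

-- An extension K = M(α) in which α has degree n over M, with f the lower coefficients
-- of the monic minimal polynomial of α.  Since α is algebraic, M(α) = M[α].
record SimpleExtension (M : HeytingField c ℓ₁ ℓ₂) c′ ℓ₁′ ℓ₂′ (n : ℕ)
       : Set (c ⊔ˡ ℓ₁ ⊔ˡ lsuc (c′ ⊔ˡ ℓ₁′ ⊔ˡ ℓ₂′)) where
  private module M = CommutativeRing (commutativeRingOf M)
  field
    heytingField : HeytingField c′ ℓ₁′ ℓ₂′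
  open CommutativeRing (commutativeRingOf heytingField) public hiding (zero)
  open RingOps rawRing public
  field
    ι         : M.Carrier → Carrier
    ι-homo    : IsRingHomomorphism M.rawRing rawRing ι
    α         : Carrier
    f         : Vector M.Carrier n
    f-root    : monic (ι ∘ f) α ≈ 0#
    f-minimal : ∀ (c : Vector M.Carrier n) → poly (ι ∘ c) α ≈ 0# → ∀ i → c i M.≈ M.0#
    generates : ∀ β → ∃₂ λ d (c : Vector M.Carrier d) → β ≈ poly (ι ∘ c) α

  private
    open IsRingHomomorphism ι-homo using (+-homo; *-homo; -‿homo; 0#-homo)
    open SemiringSum semiring using (sum-cong-≋; *-distribˡ-sum; ∑-distrib-+; sum-init-last)
    open RingProperties ring using (-‿distribˡ-*; -‿distribʳ-*; +-inverseʳ-unique)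
    open SetoidReasoning setoid

    poly-∷ : ∀ {d} (e : Vector Carrier (suc d)) x →
             poly e x ≈ e zero + x * poly (e ∘ suc) x
    poly-∷ e x = +-cong (*-identityʳ _) (begin
      sum (λ i → e (suc i) * (x * x ^ toℕ i))    ≈⟨ sum-cong-≋ (λ i → swap (e (suc i)) x _) ⟩
      sum (λ i → x * (e (suc i) * x ^ toℕ i))    ≈⟨ *-distribˡ-sum x (λ i → e (suc i) * x ^ toℕ i) ⟨
      x * poly (e ∘ suc) x                       ∎)
      where
      swap : ∀ p q r → p * (q * r) ≈ q * (p * r)
      swap p q r = trans (sym (*-assoc p q r)) (trans (*-congʳ (*-comm p q)) (*-assoc q p r))

    poly-last : ∀ {d} (e : Vector Carrier (suc d)) x →
                poly e x ≈ poly (e ∘ inject₁) x + e (fromℕ d) * x ^ d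
    poly-last {d} e x = begin
      poly e x
        ≈⟨ sum-init-last (λ i → e i * x ^ toℕ i) ⟩
      sum (λ i → e (inject₁ i) * x ^ toℕ (inject₁ i)) + e (fromℕ d) * x ^ toℕ (fromℕ d)
        ≈⟨ +-cong
             (sum-cong-≋ {d} (λ i → *-congˡ {e (inject₁ i)} (reflexive (≡.cong (x ^_) (toℕ-inject₁ i)))))
             (*-congˡ (reflexive (≡.cong (x ^_) (toℕ-fromℕ d)))) ⟩
      poly (e ∘ inject₁) x + e (fromℕ d) * x ^ d ∎

    αⁿ : α ^ n ≈ - poly (ι ∘ f) α
    αⁿ = +-inverseʳ-unique _ _ f-root

    drop : Vector M.Carrier (suc n) → Vector M.Carrier n
    drop e i = e (inject₁ i) M.+ e (fromℕ n) M.* (M.- f i)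

    drop-correct : ∀ e → poly (ι ∘ e) α ≈ poly (ι ∘ drop e) α
    drop-correct e = begin
      poly (ι ∘ e) α
        ≈⟨ poly-last (ι ∘ e) α ⟩
      p + t * α ^ n
        ≈⟨ +-congˡ (*-congˡ αⁿ) ⟩
      p + t * - poly (ι ∘ f) α
        ≈⟨ +-congˡ (trans (sym (-‿distribʳ-* _ _)) (-‿distribˡ-* _ _)) ⟩
      p + - t * poly (ι ∘ f) α
        ≈⟨ +-congˡ (*-distribˡ-sum (- t) (λ i → ι (f i) * α ^ toℕ i)) ⟩
      p + sum (λ i → - t * (ι (f i) * α ^ toℕ i))
        ≈⟨ ∑-distrib-+ (λ i → ι (e (inject₁ i)) * α ^ toℕ i) (λ i → - t * (ι (f i) * α ^ toℕ i)) ⟨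
      sum (λ i → ι (e (inject₁ i)) * α ^ toℕ i + - t * (ι (f i) * α ^ toℕ i))
        ≈⟨ sum-cong-≋ coefficient ⟩
      poly (ι ∘ drop e) α ∎
      where
      p = poly (ι ∘ e ∘ inject₁) α
      t = ι (e (fromℕ n))
      coefficient : ∀ i → ι (e (inject₁ i)) * α ^ toℕ i + - t * (ι (f i) * α ^ toℕ i)
                          ≈ ι (drop e i) * α ^ toℕ i
      coefficient i = begin
        ι (e (inject₁ i)) * α ^ toℕ i + - t * (ι (f i) * α ^ toℕ i)
          ≈⟨ +-congˡ (*-assoc _ _ _) ⟨
        ι (e (inject₁ i)) * α ^ toℕ i + - t * ι (f i) * α ^ toℕ i
          ≈⟨ distribʳ _ _ _ ⟨
        (ι (e (inject₁ i)) + - t * ι (f i)) * α ^ toℕ i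
          ≈⟨ *-congʳ (+-congˡ (trans (sym (-‿distribˡ-* _ _)) (-‿distribʳ-* _ _))) ⟩
        (ι (e (inject₁ i)) + t * - ι (f i)) * α ^ toℕ i
          ≈⟨ *-congʳ (+-congˡ (*-congˡ (-‿homo (f i)))) ⟨
        (ι (e (inject₁ i)) + t * ι (M.- f i)) * α ^ toℕ i
          ≈⟨ *-congʳ (+-congˡ (*-homo _ _)) ⟨
        (ι (e (inject₁ i)) + ι (e (fromℕ n) M.* M.- f i)) * α ^ toℕ i
          ≈⟨ *-congʳ (+-homo _ _) ⟨
        ι (drop e i) * α ^ toℕ i ∎

    reduce : ∀ d → Vector M.Carrier d → Vector M.Carrier n
    reduce zero    g = λ _ → M.0#
    reduce (suc d) g = drop (g zero Vector.∷ reduce d (g ∘ suc))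

    reduce-correct : ∀ d g → poly (ι ∘ g) α ≈ poly (ι ∘ reduce d g) α
    reduce-correct zero g = begin
      0#                                     ≈⟨ zeroˡ _ ⟨
      0# * sum (λ (i : Fin n) → α ^ toℕ i)
        ≈⟨ *-distribˡ-sum 0# (λ (i : Fin n) → α ^ toℕ i) ⟩
      sum (λ (i : Fin n) → 0# * α ^ toℕ i)   ≈⟨ sum-cong-≋ {n} (λ _ → *-congʳ (sym 0#-homo)) ⟩
      poly {n} (λ _ → ι M.0#) α              ∎
    reduce-correct (suc d) g = begin
      poly (ι ∘ g) α                             ≈⟨ poly-∷ (ι ∘ g) α ⟩
      ι (g zero) + α * poly (ι ∘ g ∘ suc) α      ≈⟨ +-congˡ (*-congˡ (reduce-correct d (g ∘ suc))) ⟩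
      ι (g zero) + α * poly (ι ∘ r) α            ≈⟨ poly-∷ (ι ∘ (g zero Vector.∷ r)) α ⟨
      poly (ι ∘ (g zero Vector.∷ r)) α           ≈⟨ drop-correct (g zero Vector.∷ r) ⟩
      poly (ι ∘ reduce (suc d) g) α              ∎
      where r = reduce d (g ∘ suc)

  powerBasis : Basis {F = M.rawRing} {E = rawRing} ι n
  powerBasis = record
    { vec         = λ i → α ^ toℕ i
    ; coord       = λ β → reduce _ (proj₁ (proj₂ (generates β)))
    ; expand      = λ β → trans (proj₂ (proj₂ (generates β))) (reduce-correct (proj₁ (generates β)) _)
    ; independent = f-minimal
    }

  norm : Carrier → M.Carrier
  norm = Basis.norm powerBasis

-- The classical axioms of ℝ, decidable total order included, which determine it up to
-- isomorphism.  With excluded middle for Set the Dedekind cuts of ℚ are a model.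
record CompleteOrderedField : Set₁ where
  infix 4 _≤_
  field
    Carrier         : Set
    _≈_             : Rel Carrier 0ℓ
    _+_ _*_         : Op₂ Carrier
    -_              : Op₁ Carrier
    0# 1#           : Carrier
    isHeytingField  : IsHeytingField _≈_ (λ x y → ¬ (x ≈ y)) _+_ _*_ -_ 0# 1#
    _≤_             : Rel Carrier 0ℓ
    isDecTotalOrder : IsDecTotalOrder _≈_ _≤_
    +-monoˡ-≤       : ∀ z {x y} → x ≤ y → (x + z) ≤ (y + z)
    *-nonNeg        : ∀ {x y} → 0# ≤ x → 0# ≤ y → 0# ≤ (x * y)
    supremum        : (P : Pred Carrier 0ℓ) → ∃ P → (∃ λ u → ∀ x → P x → x ≤ u) →
                      ∃ λ s → (∀ x → P x → x ≤ s) × (∀ u → (∀ x → P x → x ≤ u) → s ≤ u)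

module RealOps (R : CompleteOrderedField) where
  private module R = CompleteOrderedField R

  heytingField : HeytingField 0ℓ 0ℓ 0ℓ
  heytingField = record { isHeytingField = R.isHeytingField }

  decTotalOrder : DecTotalOrder 0ℓ 0ℓ 0ℓ
  decTotalOrder = record { isDecTotalOrder = R.isDecTotalOrder }

  open CommutativeRing (commutativeRingOf heytingField) public hiding (zero)
  open DecTotalOrder decTotalOrder public using (_≤_; _≟_; totalOrder)
  open ToStrict _≈_ _≤_ public using (_<_)
  open Max totalOrder public using (_⊔_; x≤x⊔y; x≤y⊔x)
  open RingOps rawRing public
  private module Order = DecTotalOrder decTotalOrder

  -- With the convention 0⁻¹ = 0.
  infix 9 _⁻¹
  _⁻¹ : Carrier → Carrier
  x ⁻¹ with x ≟ 0#
  ... | yes _   = 0#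
  ... | no  x≉0 = proj₁ (HeytingField.#⇒invertible heytingField x≉0)

  -- For n ≥ 1 and x ≥ 0 the nonnegative n-th root of x, as the supremum of the t ≥ 0 with
  -- tⁿ ≤ x.  All these satisfy t ≤ 1 ⊔ x; that bound and the element 0 are put in by hand
  -- only to make the supremum exist for every n and x.
  root : ℕ → Carrier → Carrier
  root n x = proj₁ (R.supremum P (0# , inj₁ refl) (0# ⊔ (1# ⊔ x) , bounded))
    where
    P : Pred Carrier 0ℓ
    P t = t ≈ 0# ⊎ (0# ≤ t × t ≤ (1# ⊔ x) × (t ^ n) ≤ x)
    bounded : ∀ t → P t → t ≤ (0# ⊔ (1# ⊔ x))
    bounded t (inj₁ t≈0)             = Order.trans (Order.reflexive t≈0) (x≤x⊔y _ _)
    bounded t (inj₂ (_ , t≤1⊔x , _)) = Order.trans t≤1⊔x (x≤y⊔x _ _)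

  -- Used for nonnegative entries only.
  maximum : Vector Carrier n → Carrier
  maximum = Vector.foldr _⊔_ 0#

  ℂ : RawRing 0ℓ 0ℓ
  ℂ = record
    { Carrier = Carrier × Carrier
    ; _≈_     = λ (a , b) (c , d) → a ≈ c × b ≈ d
    ; _+_     = λ (a , b) (c , d) → (a + c , b + d)
    ; _*_     = λ (a , b) (c , d) → (a * c - b * d , a * d + b * c)
    ; -_      = λ (a , b) → (- a , - b)
    ; 0#      = (0# , 0#)
    ; 1#      = (1# , 0#)
    }

  module ℂ where
    open RawRing ℂ public
    open RingOps ℂ public

  ∣_∣ : ℂ.Carrier → Carrier
  ∣ (a , b) ∣ = root 2 (a * a + b * b)

  rowNorm : Matrix ℂ.Carrier m n → Carrier
  rowNorm T = maximum (λ i → sum (λ j → ∣ T i j ∣))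

-- All the embeddings of M into ℂ, each listed once.
record Embeddings (R : CompleteOrderedField) (M : NumberField c ℓ₁ ℓ₂ m) : Set (c ⊔ˡ ℓ₁) where
  open RealOps R using (ℂ; module ℂ; maximum; ∣_∣)
  private module M = NumberField M
  field
    σ          : Fin m → M.Carrier → ℂ.Carrier
    σ-homo     : ∀ j → IsRingHomomorphism M.rawRing ℂ (σ j)
    σ-distinct : ∀ j k → (∀ γ → σ j γ ℂ.≈ σ k γ) → j ≡ k
    σ-complete : ∀ τ → IsRingHomomorphism M.rawRing ℂ τ → ∃ λ j → ∀ γ → τ γ ℂ.≈ σ j γ

  size : M.Carrier → RealOps.Carrier R
  size γ = maximum (λ j → ∣ σ j γ ∣)

-- conjugate j 1, …, conjugate j n are the roots, with multiplicity, of the polynomial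
-- obtained by applying σ j to the coefficients of f.
record Conjugates {R : CompleteOrderedField} {M : NumberField c ℓ₁ ℓ₂ m}
                  (Σ : Embeddings R M)
                  (L : SimpleExtension (NumberField.heytingField M) c′ ℓ₁′ ℓ₂′ n) : Set where
  open RealOps R using (ℂ; module ℂ; maximum; ∣_∣)
  open Embeddings Σ using (σ)
  open SimpleExtension L using (f)
  field
    conjugate : Fin m → Fin n → ℂ.Carrier
    factors   : ∀ j z →
                ℂ.monic (λ i → σ j (f i)) z ℂ.≈ ℂ.product (λ k → z ℂ.+ (ℂ.- conjugate j k))

  sizeα : RealOps.Carrier R
  sizeα = maximum (λ j → maximum (λ k → ∣ conjugate j k ∣))

-- The matrix with rows (ω₁⁽ʲ⁾, …, ωₘ⁽ʲ⁾).
embeddingMatrix : {R : CompleteOrderedField} {M : NumberField c ℓ₁ ℓ₂ m} →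
                  IntegralBasis M → Embeddings R M → Matrix (RealOps.ℂ.Carrier R) m m
embeddingMatrix B Σ j i = Embeddings.σ Σ j (IntegralBasis.ω B i)

height : Vector ℤ m → ℕ
height x = Vector.foldr ℕ._⊔_ 0 (λ i → ℤ.∣ x i ∣)

{-# OPTIONS --safe #-}
-- Write |γ| for the size of γ. For every embedding σⱼ the product of the factors X⁽ʲ⁾ −
-- α⁽ʲᵏ⁾Y⁽ʲ⁾ over k is μ⁽ʲ⁾, so one of them is at most the n-th root of the size of μ, hence at
-- most |α| |Y|, and |X⁽ʲ⁾| ≤ 2 |α| |Y|. Inverting S bounds the coordinates of X and Y by c₂
-- |X| and c₂ |Y|. For Y one also needs 2 |α| ≥ 1: otherwise the constant term of f, which is
-- integral and nonzero, has all its conjugates at most |α|ⁿ ≤ 1/2, and its iterates under γ ↦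
-- − γ² are nonzero integral elements with conjugates tending to 0, so that their integral
-- coordinates eventually vanish.
module Submission where

open import Algebra.Apartness.Bundles using (HeytingField)
open import Algebra.Bundles using (CommutativeRing)
import Algebra.Construct.NaturalChoice.Max as Max
open import Algebra.Morphism.Structures using (IsRingHomomorphism)
import Algebra.Properties.CommutativeSemiring.Exp as SemiringExp
import Algebra.Properties.Monoid.Mult.TCOptimised as OptimisedMult
import Algebra.Properties.Ring as RingProperties
import Algebra.Properties.Semiring.Mult as SemiringMult
import Algebra.Properties.Semiring.Sum as SemiringSum
import Algebra.Solver.Ring as RingSolver
open import Algebra.Solver.Ring.AlmostCommutativeRing
  using (fromCommutativeRing; _-Raw-AlmostCommutative⟶_)
open import Defs
open import Data.Fin.Base using (Fin; zero; suc; toℕ; fromℕ; inject₁; punchIn)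
open import Data.Fin.Properties using (toℕ-fromℕ; toℕ-inject₁; all?; any?; ¬∀⟶∃¬)
open import Data.Integer.Base as ℤ using (ℤ; +_; -[1+_])
import Data.Integer.Properties as ℤ
open import Data.Maybe.Base using (map)
open import Data.Nat.Base as ℕ using (ℕ; zero; suc; s≤s; z≤n)
import Data.Nat.Properties as ℕ
open import Data.Product.Base using (∃; ∃₂; _×_; _,_; proj₁; proj₂)
open import Data.Sum.Base using (_⊎_; inj₁; inj₂)
open import Data.Vec.Functional as Vector using (Vector)
open import Function.Base using (_∘_)
open import Level using (Level; 0ℓ) renaming (_⊔_ to _⊔ˡ_)
open import Relation.Binary.Bundles using (DecTotalOrder)
open import Relation.Binary.PropositionalEquality.Core as ≡ using (_≡_)
import Relation.Binary.Reasoning.Setoid as SetoidReasoning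
open import Relation.Nullary using (¬_; Dec; yes; no; contradiction)
open import Relation.Nullary.Decidable using (_×-dec_; dec⇒maybe)

-- The inequality 2|α| ≥ 1 says that a nonzero integral element cannot have all its conjugates tiny.
-- The usual reason is that their product is a nonzero rational integer. Here discreteness comes
-- from the coordinates instead: one of them is a nonzero integer, so the size is at least 1/c₂.
-- This bound depends on the basis, and only iteration sets it against the fixed bound 1/2. The
-- iterates must stay integral, and `IsIntegral` asks for an explicit monic integer polynomial; for
-- - x² such a polynomial can be read off from p(x) p(- x).
--
-- The norm is by definition a determinant over M. Expanding it gives Yⁿ f(X/Y) in denominator-free
-- form, an expression in X, Y and the coefficients of f. Each embedding of M can be applied to that
-- expression directly, and the given factorization of the conjugate of f turns it into the product
-- over k.
--
-- The small factor is found by contradiction, by comparing every factor with |α| |Y| itself.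

-- Integers in a commutative ring, and integrality of - x²

module IntegerPolynomials {c ℓ : Level} (A : CommutativeRing c ℓ) where
  open CommutativeRing A hiding (zero)
  open RingOps rawRing
  open RingProperties ring using (-0#≈0#; -‿distribˡ-*; -‿distribʳ-*; -‿involutive; -‿+-comm)
  open SemiringSum semiring using (sum-cong-≋; *-distribˡ-sum)
  private
    module Mult = SemiringMult semiring
    module OM = OptimisedMult +-monoid
  open SetoidReasoning setoid

  fromℤ-neg : ∀ i → fromℤ (ℤ.- i) ≈ - fromℤ i
  fromℤ-neg (+ zero)  = sym -0#≈0#
  fromℤ-neg (+ suc _) = refl
  fromℤ-neg -[1+ _ ]  = sym (-‿involutive _)

  private
    fromℤ-⊖ : ∀ m n → fromℤ (m ℤ.⊖ n) ≈ m · 1# - n · 1#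
    fromℤ-⊖ m       zero    = sym (trans (+-congˡ -0#≈0#) (+-identityʳ _))
    fromℤ-⊖ zero    (suc n) = sym (+-identityˡ _)
    fromℤ-⊖ (suc m) (suc n) = begin
      fromℤ (suc m ℤ.⊖ suc n)                ≡⟨ ≡.cong fromℤ (ℤ.[1+m]⊖[1+n]≡m⊖n m n) ⟩
      fromℤ (m ℤ.⊖ n)                        ≈⟨ fromℤ-⊖ m n ⟩
      a - b                                  ≈⟨ +-congʳ (+-identityˡ _) ⟨
      (0# + a) - b                           ≈⟨ +-congʳ (+-congʳ (-‿inverseʳ _)) ⟨
      ((1# - 1#) + a) - b                    ≈⟨ +-congʳ (+-assoc _ _ _) ⟩
      (1# + (- 1# + a)) - b                  ≈⟨ +-congʳ (+-congˡ (+-comm _ _)) ⟩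
      (1# + (a - 1#)) - b                    ≈⟨ +-congʳ (+-assoc _ _ _) ⟨
      ((1# + a) - 1#) - b                    ≈⟨ +-assoc _ _ _ ⟩
      (1# + a) + (- 1# - b)                  ≈⟨ +-congˡ (-‿+-comm _ _) ⟩
      (1# + a) - (1# + b)                    ∎
      where a = m · 1#
            b = n · 1#

  fromℤ-+ : ∀ i j → fromℤ (i ℤ.+ j) ≈ fromℤ i + fromℤ j
  fromℤ-+ (+ m)    (+ n)    = Mult.×-homo-+ 1# m n
  fromℤ-+ (+ m)    -[1+ n ] = fromℤ-⊖ m (suc n)
  fromℤ-+ -[1+ m ] (+ n)    = trans (fromℤ-⊖ n (suc m)) (+-comm _ _)
  fromℤ-+ -[1+ m ] -[1+ n ] = begin
    - (1# + (1# + (m ℕ.+ n) · 1#))      ≈⟨ -‿cong (+-congˡ (+-congˡ (Mult.×-homo-+ 1# m n))) ⟩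
    - (1# + (1# + (m · 1# + n · 1#)))   ≈⟨ -‿cong (+-congˡ (+-assoc _ _ _)) ⟨
    - (1# + ((1# + m · 1#) + n · 1#))   ≈⟨ -‿cong (+-congˡ (+-comm _ _)) ⟩
    - (1# + (n · 1# + (1# + m · 1#)))   ≈⟨ -‿cong (+-assoc _ _ _) ⟨
    - ((1# + n · 1#) + (1# + m · 1#))   ≈⟨ -‿cong (+-comm _ _) ⟩
    - ((1# + m · 1#) + (1# + n · 1#))   ≈⟨ -‿+-comm _ _ ⟨
    - (1# + m · 1#) - (1# + n · 1#)     ∎

  private
    fromℤ-pos-* : ∀ m j → fromℤ (+ m ℤ.* j) ≈ fromℤ (+ m) * fromℤ j
    fromℤ-pos-* m (+ n) =
      trans (reflexive (≡.cong fromℤ (≡.sym (ℤ.pos-* m n)))) (Mult.×1-homo-* m n)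
    fromℤ-pos-* m -[1+ n ] = begin
      fromℤ (+ m ℤ.* -[1+ n ])          ≡⟨ ≡.cong fromℤ (ℤ.neg-distribʳ-* (+ m) (+ suc n)) ⟨
      fromℤ (ℤ.- (+ m ℤ.* + suc n))     ≈⟨ fromℤ-neg (+ m ℤ.* + suc n) ⟩
      - fromℤ (+ m ℤ.* + suc n)         ≈⟨ -‿cong (fromℤ-pos-* m (+ suc n)) ⟩
      - (m · 1# * suc n · 1#)           ≈⟨ -‿distribʳ-* _ _ ⟩
      m · 1# * - (suc n · 1#)           ∎

  fromℤ-* : ∀ i j → fromℤ (i ℤ.* j) ≈ fromℤ i * fromℤ j
  fromℤ-* (+ m)    j = fromℤ-pos-* m j
  fromℤ-* -[1+ m ] j = begin
    fromℤ (-[1+ m ] ℤ.* j)          ≡⟨ ≡.cong fromℤ (ℤ.neg-distribˡ-* (+ suc m) j) ⟨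
    fromℤ (ℤ.- (+ suc m ℤ.* j))     ≈⟨ fromℤ-neg (+ suc m ℤ.* j) ⟩
    - fromℤ (+ suc m ℤ.* j)         ≈⟨ -‿cong (fromℤ-pos-* (suc m) j) ⟩
    - (suc m · 1# * fromℤ j)        ≈⟨ -‿distribˡ-* _ _ ⟩
    - (suc m · 1#) * fromℤ j        ∎

  -- The type-checking optimised multiples make the solver's constants 0 and 1 reduce to 0# and 1#.
  private
    coefficient : ℤ → Carrier
    coefficient (+ n)    = n OM.× 1#
    coefficient -[1+ n ] = - (suc n OM.× 1#)

    coefficient≈fromℤ : ∀ i → coefficient i ≈ fromℤ i
    coefficient≈fromℤ (+ n)    = sym (OM.×ᵤ≈× n 1#)
    coefficient≈fromℤ -[1+ n ] = -‿cong (sym (OM.×ᵤ≈× (suc n) 1#))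

    morphism : ℤ.+-*-rawRing -Raw-AlmostCommutative⟶ fromCommutativeRing A
    morphism = record
      { ⟦_⟧    = coefficient
      ; +-homo = λ i j → transport (i ℤ.+ j) (fromℤ-+ i j) (+-cong (coefficient≈fromℤ i) (coefficient≈fromℤ j))
      ; *-homo = λ i j → transport (i ℤ.* j) (fromℤ-* i j) (*-cong (coefficient≈fromℤ i) (coefficient≈fromℤ j))
      ; -‿homo = λ i → transport (ℤ.- i) (fromℤ-neg i) (-‿cong (coefficient≈fromℤ i))
      ; 0-homo = refl
      ; 1-homo = refl
      }
      where
      transport : ∀ i {x y} → fromℤ i ≈ x → y ≈ x → coefficient i ≈ y
      transport i p q = trans (coefficient≈fromℤ i) (trans p (sym q))

  module Solver = RingSolver ℤ.+-*-rawRing (fromCommutativeRing A) morphism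
    (λ i j → map (λ i≡j → reflexive (≡.cong coefficient i≡j)) (dec⇒maybe (i ℤ.≟ j)))
  open Solver using (solve; con; _:+_; _:*_; :-_; _:-_; _:=_)

  poly-∷ : ∀ {d} (e : Vector Carrier (suc d)) x →
           poly e x ≈ e zero + x * poly (e ∘ suc) x
  poly-∷ e x = +-cong (*-identityʳ _) (trans
    (sum-cong-≋ (λ i → solve 3 (λ p q r → p :* (q :* r) := q :* (p :* r)) refl (e (suc i)) x (x ^ toℕ i)))
    (sym (*-distribˡ-sum x (λ i → e (suc i) * x ^ toℕ i))))

  monic-∷ : ∀ {d} (e : Vector Carrier (suc d)) x →
            monic e x ≈ e zero + x * monic (e ∘ suc) x
  monic-∷ {d} e x = trans (+-congʳ (poly-∷ e x))
    (solve 4 (λ a x p q → a :+ x :* p :+ x :* q := a :+ x :* (p :+ q)) refl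
      (e zero) x (poly (e ∘ suc) x) (x ^ d))

  -- The values at z of the polynomials of degree < d with integer coefficients.
  data IsPolyValue (z : Carrier) : ℕ → Carrier → Set (c ⊔ˡ ℓ) where
    null : ∀ {d v} → v ≈ 0# → IsPolyValue z d v
    cons : ∀ {d v w} k → IsPolyValue z d w → v ≈ fromℤ k + z * w → IsPolyValue z (suc d) v

  module _ {z : Carrier} where
    resp : ∀ {d v w} → v ≈ w → IsPolyValue z d v → IsPolyValue z d w
    resp v≈w (null v≈0)   = null (trans (sym v≈w) v≈0)
    resp v≈w (cons k p e) = cons k p (trans (sym v≈w) e)

    weaken : ∀ {d v} → IsPolyValue z d v → IsPolyValue z (suc d) v
    weaken (null v≈0)   = null v≈0
    weaken (cons k p e) = cons k (weaken p) e

    constant : ∀ {d} k → IsPolyValue z (suc d) (fromℤ k)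
    constant k = cons k (null refl) (solve 2 (λ a z → a := a :+ z :* con ℤ.0ℤ) refl (fromℤ k) z)

    shift : ∀ {d v} → IsPolyValue z d v → IsPolyValue z (suc d) (z * v)
    shift p = cons ℤ.0ℤ p (sym (+-identityˡ _))

    sum-value : ∀ {d v w} → IsPolyValue z d v → IsPolyValue z d w → IsPolyValue z d (v + w)
    sum-value (null v≈0) q = resp (trans (sym (+-identityˡ _)) (+-congʳ (sym v≈0))) q
    sum-value p (null w≈0) = resp (trans (sym (+-identityʳ _)) (+-congˡ (sym w≈0))) p
    sum-value (cons {w = v′} k p e) (cons {w = w′} l q f) = cons (k ℤ.+ l) (sum-value p q)
      (trans (+-cong e f) (trans
        (solve 5 (λ a b z v w → (a :+ z :* v) :+ (b :+ z :* w) := (a :+ b) :+ z :* (v :+ w)) refl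
          (fromℤ k) (fromℤ l) z v′ w′)
        (+-congʳ (sym (fromℤ-+ k l)))))

    scale : ∀ {d v} l → IsPolyValue z d v → IsPolyValue z d (fromℤ l * v)
    scale l (null v≈0) = null (trans (*-congˡ v≈0) (zeroʳ _))
    scale l (cons {w = w} k p e) = cons (l ℤ.* k) (scale l p)
      (trans (*-congˡ e) (trans
        (solve 4 (λ l k z w → l :* (k :+ z :* w) := (l :* k) :+ z :* (l :* w)) refl
          (fromℤ l) (fromℤ k) z w)
        (+-congʳ (sym (fromℤ-* l k)))))

    negate : ∀ {d v} → IsPolyValue z d v → IsPolyValue z d (- v)
    negate {v = v} p = resp
      -- `fromℤ ℤ.-1ℤ` unfolds to `- (1# + 0#)`, and the solver term has to match this.
      (solve 1 (λ v → (:- (con (+ 1) :+ con (+ 0))) :* v := :- v) refl v) (scale ℤ.-1ℤ p)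

    coefficients : ∀ {d v} → IsPolyValue z d v → ∃ λ (k : Vector ℤ d) → v ≈ poly (fromℤ ∘ k) z
    coefficients {zero}  (null v≈0)   = (λ ()) , v≈0
    coefficients {suc d} (null v≈0)   with coefficients {d} (null refl)
    ... | k , e = (ℤ.0ℤ Vector.∷ k) ,
      trans v≈0 (sym (trans (poly-∷ (fromℤ ∘ (ℤ.0ℤ Vector.∷ k)) z)
        (trans (+-identityˡ _) (trans (*-congˡ (sym e)) (zeroʳ z)))))
    coefficients {suc d} (cons k p e) with coefficients p
    ... | l , f = (k Vector.∷ l) ,
      trans e (trans (+-congˡ (*-congˡ f)) (sym (poly-∷ (fromℤ ∘ (k Vector.∷ l)) z)))

  -- Splitting p into even and odd parts, p(x) = e + x o, the product p(x) p(−x) = e² − x² o²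
  -- is a polynomial in z = − x², and is monic in z.
  even-odd : ∀ {d} (k : Vector ℤ d) x → let z = - (x * x) in
    ∃₂ λ e o → ∃ λ r →
      monic (fromℤ ∘ k) x ≈ e + x * o × e * e + z * (o * o) ≈ z ^ d + r ×
      IsPolyValue z (suc d) e × IsPolyValue z d o × IsPolyValue z d r
  even-odd {zero} k x =
    fromℤ (+ 1) , 0# , 0# ,
    solve 1 (λ x → con (+ 0) :+ con (+ 1) := (con (+ 1) :+ con (+ 0)) :+ x :* con (+ 0)) refl x ,
    solve 1 (λ z → (con (+ 1) :+ con (+ 0)) :* (con (+ 1) :+ con (+ 0)) :+ z :* (con (+ 0) :* con (+ 0))
                   := con (+ 1) :+ con (+ 0)) refl (- (x * x)) ,
    constant (+ 1) , null refl , null refl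
  even-odd {suc d} k x with even-odd (k ∘ suc) x
  ... | e , o , r , split , product≈ , pe , po , pr =
    -- Passing from p to a + x p swaps the parts: a + x (e + x o) = (a - z o) + x e. The product
    -- becomes z (e² + z o²) + a² - 2t, so the leading power gains one factor z. The degree bound on
    -- `e` is carried along because `e` is the next odd part, whose bound controls t.
    a - z * o , e , z * r + (a * a - (t + t)) ,
    trans (monic-∷ (fromℤ ∘ k) x) (trans (+-congˡ (*-congˡ split))
      (solve 4 (λ a x e o → a :+ x :* (e :+ x :* o) := (a :- (:- (x :* x)) :* o) :+ x :* e) refl a x e o)) ,
    (begin
      (a - z * o) * (a - z * o) + z * (e * e)
        ≈⟨ solve 4 (λ a z e o → (a :- z :* o) :* (a :- z :* o) :+ z :* (e :* e)
             := z :* (e :* e :+ z :* (o :* o)) :+ (a :* a :- (a :* (z :* o) :+ a :* (z :* o)))) refl a z e o ⟩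
      z * (e * e + z * (o * o)) + (a * a - (t + t))
        ≈⟨ +-congʳ (*-congˡ product≈) ⟩
      z * (z ^ d + r) + (a * a - (t + t))
        ≈⟨ solve 4 (λ z p r s → z :* (p :+ r) :+ s := z :* p :+ (z :* r :+ s)) refl z (z ^ d) r (a * a - (t + t)) ⟩
      z ^ suc d + (z * r + (a * a - (t + t))) ∎) ,
    sum-value (constant (k zero)) (negate (weaken (shift po))) ,
    pe ,
    sum-value (shift pr)
      (sum-value (scale (k zero) (constant (k zero))) (negate (sum-value pt pt)))
    where
    z = - (x * x)
    a = fromℤ (k zero)
    t = a * (z * o)
    pt : IsPolyValue z (suc d) t
    pt = scale (k zero) (shift po)

  -- If p(x) = 0 then p(x) p(- x) = 0. The sign makes this product monic in the new variable for
  -- either parity of the degree d: its leading term is (- 1)ᵈ x²ᵈ = (- x²)ᵈ.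
  negSquare-integral : ∀ {x} → IsIntegral x → IsIntegral (- (x * x))
  negSquare-integral {x} (d , k , root) with even-odd k x
  ... | e , o , r , split , product≈ , _ , _ , pr with coefficients pr
  ... | l , r≈ = d , l , (begin
    poly (fromℤ ∘ l) z + z ^ d    ≈⟨ +-congʳ (sym r≈) ⟩
    r + z ^ d                     ≈⟨ +-comm _ _ ⟩
    z ^ d + r                     ≈⟨ sym product≈ ⟩
    e * e + z * (o * o)
      ≈⟨ solve 3 (λ x e o → e :* e :+ (:- (x :* x)) :* (o :* o) := (e :+ x :* o) :* (e :- x :* o)) refl x e o ⟩
    (e + x * o) * (e - x * o)     ≈⟨ *-congʳ (trans (sym split) root) ⟩
    0# * (e - x * o)              ≈⟨ zeroˡ _ ⟩
    0#                            ∎)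
    where z = - (x * x)

-- Determinant of the multiplication matrix of X - αY

module Determinants {c ℓ : Level} (A : CommutativeRing c ℓ) where
  open CommutativeRing A hiding (zero)
  open RingOps rawRing
  open IntegerPolynomials A using (module Solver)
  open Solver using (solve; con; _:+_; _:*_; :-_; _:-_; _:=_)
  open SemiringSum semiring using (sum-cong-≋; sum-replicate-zero; sum-init-last)
  open SemiringExp commutativeSemiring using (^-congˡ; ^-distrib-*)
  open SetoidReasoning setoid

  sum-zero : ∀ {n} {v : Vector Carrier n} → (∀ i → v i ≈ 0#) → sum v ≈ 0#
  sum-zero {n} v≈0 = trans (sum-cong-≋ v≈0) (sum-replicate-zero n)

  minor : ∀ {n} → Matrix Carrier (suc n) (suc n) → Fin (suc n) → Matrix Carrier n n
  minor U j i k = U (suc i) (punchIn j k)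

  cofactorTerm : ∀ {n} → Matrix Carrier (suc n) (suc n) → Fin (suc n) → Carrier
  cofactorTerm U j = (- 1#) ^ toℕ j * (U zero j * det (minor U j))

  cofactorTerm-zero : ∀ {n} (U : Matrix Carrier (suc n) (suc n)) j →
                      U zero j ≈ 0# → cofactorTerm U j ≈ 0#
  cofactorTerm-zero U j u≈0 = trans (*-congˡ (trans (*-congʳ u≈0) (zeroˡ _))) (zeroʳ _)

  -- In the expansion along the first row, the zero column itself contributes a zero entry, and
  -- every other minor still contains a zero first column.
  det-zero-column : ∀ {n} (U : Matrix Carrier (suc n) (suc n)) → (∀ i → U i zero ≈ 0#) → det U ≈ 0#
  det-zero-column {n} U column≈0 = sum-zero {v = cofactorTerm U} (term n U column≈0)
    where
    term : ∀ n (U : Matrix Carrier (suc n) (suc n)) → (∀ i → U i zero ≈ 0#) →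
           ∀ j → cofactorTerm U j ≈ 0#
    term n       U column≈0 zero    = cofactorTerm-zero U zero (column≈0 zero)
    term (suc n) U column≈0 (suc j) =
      trans (*-congˡ (trans (*-congˡ (det-zero-column (minor U (suc j)) (column≈0 ∘ suc))) (zeroʳ _))) (zeroʳ _)

  det-first-column : ∀ {n} (U : Matrix Carrier (suc n) (suc n)) → (∀ i → U (suc i) zero ≈ 0#) →
                     det U ≈ U zero zero * det (minor U zero)
  det-first-column {n} U below≈0 = trans
    (+-cong (*-identityˡ _) (sum-zero (later n U below≈0))) (+-identityʳ _)
    where
    later : ∀ n (U : Matrix Carrier (suc n) (suc n)) → (∀ i → U (suc i) zero ≈ 0#) →
            ∀ j → cofactorTerm U (suc j) ≈ 0#
    later (suc n) U below≈0 j =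
      trans (*-congˡ (trans (*-congˡ (det-zero-column (minor U (suc j)) below≈0)) (zeroʳ _))) (zeroʳ _)

  det-triangular : ∀ {n} u (U : Matrix Carrier n n) → (∀ i → U i i ≈ u) →
                   (∀ i j → toℕ j ℕ.< toℕ i → U i j ≈ 0#) → det U ≈ u ^ n
  det-triangular {zero}  u U diagonal below = refl
  det-triangular {suc n} u U diagonal below = trans
    (det-first-column U (λ i → below (suc i) zero (s≤s z≤n)))
    (*-cong (diagonal zero)
      (det-triangular u (minor U zero) (diagonal ∘ suc) (λ i j j<i → below (suc i) (suc j) (s≤s j<i))))

  -- Yⁿ f(X/Y) for the monic polynomial f with the given lower coefficients.
  homogenize : ∀ {n} → Vector Carrier n → Carrier → Carrier → Carrier
  homogenize {zero}  f X Y = 1#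
  homogenize {suc n} f X Y = X * homogenize (f ∘ suc) X Y + f zero * Y ^ suc n

  -- The matrix of X − Yα in the basis 1, α, …, αⁿ when f(α) = 0.
  record IsCompanionPencil {n} (f : Vector Carrier (suc n)) (X Y : Carrier)
                           (U : Matrix Carrier (suc n) (suc n)) : Set ℓ where
    field
      inner : ∀ i j → U i (inject₁ j) ≈ X * 1ᴹ i (inject₁ j) - Y * 1ᴹ i (suc j)
      last  : ∀ i → U i (fromℕ n) ≈ X * 1ᴹ i (fromℕ n) + Y * f i

  1ᴹ-diagonal : ∀ {n} (i : Fin n) → 1ᴹ i i ≈ 1#
  1ᴹ-diagonal zero    = refl
  1ᴹ-diagonal (suc i) = 1ᴹ-diagonal i

  1ᴹ-below : ∀ {m} (i j : Fin m) → toℕ j ℕ.< toℕ i → 1ᴹ i j ≈ 0#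
  1ᴹ-below (suc i) zero    _         = refl
  1ᴹ-below (suc i) (suc j) (s≤s j<i) = 1ᴹ-below i j j<i

  private
    1ᴹ-suc-inject₁ : ∀ {n} (i : Fin n) (j : Fin n) → toℕ j ℕ.≤ toℕ i → 1ᴹ (suc i) (inject₁ j) ≈ 0#
    1ᴹ-suc-inject₁ i       zero    _         = refl
    1ᴹ-suc-inject₁ (suc i) (suc j) (s≤s j≤i) = 1ᴹ-suc-inject₁ i j j≤i

    punchIn-fromℕ : ∀ n (k : Fin n) → punchIn (fromℕ n) k ≡ inject₁ k
    punchIn-fromℕ (suc n) zero    = ≡.refl
    punchIn-fromℕ (suc n) (suc k) = ≡.cong suc (punchIn-fromℕ n k)

    signs : ∀ n y → (- 1#) ^ n * (- y) ^ n ≈ y ^ n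
    signs n y = trans (sym (^-distrib-* (- 1#) (- y) n))
      (^-congˡ n (solve 1 (λ y → (:- con (+ 1)) :* (:- y) := y) refl y))

  -- For size at least 2 the first row has only two possibly nonzero entries, X at the left and Y f₀
  -- at the right. The minor of X is the pencil of `f ∘ suc`. The minor of Y f₀ is upper triangular
  -- with diagonal - Y, and the power of - Y absorbs the cofactor sign.
  det-companion : ∀ {n} {f : Vector Carrier (suc n)} {X Y} {U} → IsCompanionPencil f X Y U →
                  det U ≈ homogenize f X Y
  det-companion {zero} {f} {X} {Y} {U} pencil = begin
    1# * (U zero zero * 1#) + 0#          ≈⟨ +-congʳ (*-congˡ (*-congʳ (last zero))) ⟩
    1# * ((X * 1# + Y * f zero) * 1#) + 0#
      ≈⟨ solve 3 (λ X Y f → con (+ 1) :* ((X :* con (+ 1) :+ Y :* f) :* con (+ 1)) :+ con (+ 0)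
           := X :* con (+ 1) :+ f :* (Y :* con (+ 1))) refl X Y (f zero) ⟩
    X * 1# + f zero * (Y * 1#)            ∎
    where open IsCompanionPencil pencil
  det-companion {suc n} {f} {X} {Y} {U} pencil = begin
    cofactorTerm U zero + sum (cofactorTerm U ∘ suc)
      ≈⟨ +-congˡ (sum-init-last (cofactorTerm U ∘ suc)) ⟩
    cofactorTerm U zero + (sum (cofactorTerm U ∘ suc ∘ inject₁) + cofactorTerm U (fromℕ (suc n)))
      ≈⟨ +-cong first (+-cong (sum-zero middle) final) ⟩
    X * homogenize (f ∘ suc) X Y + (0# + f zero * Y ^ suc (suc n))
      ≈⟨ +-congˡ (+-identityˡ _) ⟩
    homogenize f X Y ∎
    where
    open IsCompanionPencil pencil

    first : cofactorTerm U zero ≈ X * homogenize (f ∘ suc) X Y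
    first = trans (*-identityˡ _) (*-cong
      (trans (inner zero zero) (solve 2 (λ X Y → X :* con (+ 1) :- Y :* con (+ 0) := X) refl X Y))
      (det-companion {f = f ∘ suc} {U = minor U zero} (record
        { inner = λ i j → inner (suc i) (suc j)
        ; last  = λ i → last (suc i)
        })))

    middle : ∀ j → cofactorTerm U (suc (inject₁ j)) ≈ 0#
    middle j = cofactorTerm-zero U (suc (inject₁ j)) (trans (inner zero (suc j))
      (solve 2 (λ X Y → X :* con (+ 0) :- Y :* con (+ 0) := con (+ 0)) refl X Y))

    entry : ∀ i k → minor U (fromℕ (suc n)) i k ≈ X * 1ᴹ (suc i) (inject₁ k) - Y * 1ᴹ i k
    entry i k = trans (reflexive (≡.cong (U (suc i)) (punchIn-fromℕ (suc n) k))) (inner (suc i) k)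

    corner : det (minor U (fromℕ (suc n))) ≈ (- Y) ^ suc n
    corner = det-triangular (- Y) (minor U (fromℕ (suc n)))
      (λ i → trans (entry i i) (trans
        (+-cong (*-congˡ (1ᴹ-suc-inject₁ i i ℕ.≤-refl)) (-‿cong (*-congˡ (1ᴹ-diagonal i))))
        (solve 2 (λ X Y → X :* con (+ 0) :- Y :* con (+ 1) := :- Y) refl X Y)))
      (λ i j j<i → trans (entry i j) (trans
        (+-cong (*-congˡ (1ᴹ-suc-inject₁ i j (ℕ.<⇒≤ j<i))) (-‿cong (*-congˡ (1ᴹ-below i j j<i))))
        (solve 2 (λ X Y → X :* con (+ 0) :- Y :* con (+ 0) := con (+ 0)) refl X Y)))

    final : cofactorTerm U (fromℕ (suc n)) ≈ f zero * Y ^ suc (suc n)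
    final = begin
      (- 1#) ^ toℕ (fromℕ (suc n)) * (U zero (fromℕ (suc n)) * det (minor U (fromℕ (suc n))))
        ≈⟨ *-cong (reflexive (≡.cong ((- 1#) ^_) (toℕ-fromℕ (suc n)))) (*-cong (last zero) corner) ⟩
      (- 1#) ^ suc n * ((X * 0# + Y * f zero) * (- Y) ^ suc n)
        ≈⟨ solve 5 (λ s X Y f t → s :* ((X :* con (+ 0) :+ Y :* f) :* t) := (f :* Y) :* (s :* t)) refl
             ((- 1#) ^ suc n) X Y (f zero) ((- Y) ^ suc n) ⟩
      (f zero * Y) * ((- 1#) ^ suc n * (- Y) ^ suc n)
        ≈⟨ *-congˡ (signs (suc n) Y) ⟩
      (f zero * Y) * Y ^ suc n
        ≈⟨ *-assoc _ _ _ ⟩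
      f zero * Y ^ suc (suc n) ∎

  -- Links the form in X and Y to the values of `monic f`, which is where the factorization by
  -- conjugates is given.
  homogenize-monic : ∀ {n} (f : Vector Carrier n) z Y → homogenize f (z * Y) Y ≈ Y ^ n * monic f z
  homogenize-monic {zero}  f z Y = solve 0 (con (+ 1) := con (+ 1) :* (con (+ 0) :+ con (+ 1))) refl
  homogenize-monic {suc n} f z Y = begin
    z * Y * homogenize (f ∘ suc) (z * Y) Y + f zero * Y ^ suc n
      ≈⟨ +-congʳ (*-congˡ (homogenize-monic (f ∘ suc) z Y)) ⟩
    z * Y * (Y ^ n * monic (f ∘ suc) z) + f zero * Y ^ suc n
      ≈⟨ solve 5 (λ z Y p m a → z :* Y :* (p :* m) :+ a :* (Y :* p) := Y :* p :* (a :+ z :* m)) refl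
           z Y (Y ^ n) (monic (f ∘ suc) z) (f zero) ⟩
    Y ^ suc n * (f zero + z * monic (f ∘ suc) z)
      ≈⟨ *-congˡ (sym (IntegerPolynomials.monic-∷ A f z)) ⟩
    Y ^ suc n * monic f z ∎

  homogenize-zero : ∀ {n} (f : Vector Carrier n) X {Y} → Y ≈ 0# → homogenize f X Y ≈ X ^ n
  homogenize-zero {zero}  f X Y≈0 = refl
  homogenize-zero {suc n} f X {Y} Y≈0 = begin
    X * homogenize (f ∘ suc) X Y + f zero * (Y * Y ^ n)
      ≈⟨ +-cong (*-congˡ (homogenize-zero (f ∘ suc) X Y≈0)) (*-congˡ (trans (*-congʳ Y≈0) (zeroˡ _))) ⟩
    X * X ^ n + f zero * 0#    ≈⟨ +-congˡ (zeroʳ _) ⟩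
    X * X ^ n + 0#             ≈⟨ +-identityʳ _ ⟩
    X ^ suc n                  ∎

  homogenize-cong : ∀ {n} (f : Vector Carrier n) {X X′ Y Y′} → X ≈ X′ → Y ≈ Y′ →
                    homogenize f X Y ≈ homogenize f X′ Y′
  homogenize-cong {zero}  f X≈ Y≈ = refl
  homogenize-cong {suc n} f X≈ Y≈ =
    +-cong (*-cong X≈ (homogenize-cong (f ∘ suc) X≈ Y≈)) (*-congˡ (^-congˡ (suc n) Y≈))

  product-cong : ∀ {n} {u v : Vector Carrier n} → (∀ k → u k ≈ v k) → product u ≈ product v
  product-cong {zero}  u≈v = refl
  product-cong {suc n} u≈v = *-cong (u≈v zero) (product-cong (u≈v ∘ suc))

  product-constant : ∀ n x → product {n} (λ _ → x) ≈ x ^ n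
  product-constant zero    x = refl
  product-constant (suc n) x = *-congˡ (product-constant n x)

  product-scale : ∀ {n} y (v : Vector Carrier n) → product (λ k → y * v k) ≈ y ^ n * product v
  product-scale {zero}  y v = sym (*-identityˡ _)
  product-scale {suc n} y v = trans (*-congˡ (product-scale y (v ∘ suc)))
    (solve 4 (λ y a p q → y :* a :* (p :* q) := y :* p :* (a :* q)) refl y (v zero) (y ^ n) (product (v ∘ suc)))

-- Cancellation in Heyting fields

module HeytingFields {c ℓ₁ ℓ₂ : Level} (F : HeytingField c ℓ₁ ℓ₂) where
  open HeytingField F using (_#_; #⇒invertible; invertible⇒#; #-irrefl; tight)
  open CommutativeRing (commutativeRingOf F) hiding (zero)
  open IntegerPolynomials (commutativeRingOf F) using (module Solver)
  open Solver using (solve; con; _:*_; _:-_; _:=_)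
  open SetoidReasoning setoid

  1≉0 : ¬ (1# ≈ 0#)
  1≉0 1≈0 = #-irrefl 1≈0 (invertible⇒# (1# ,
    solve 0 (con (+ 1) :* (con (+ 1) :- con (+ 0)) := con (+ 1)) refl ,
    solve 0 ((con (+ 1) :- con (+ 0)) :* con (+ 1) := con (+ 1)) refl))

  private
    apart-cancel : ∀ {x y} → x # 0# → x * y ≈ 0# → y ≈ 0#
    apart-cancel {x} {y} x#0 xy≈0 with #⇒invertible x#0
    ... | z , z[x-0]≈1 , _ = begin
      y                  ≈⟨ *-identityˡ y ⟨
      1# * y             ≈⟨ *-congʳ z[x-0]≈1 ⟨
      z * (x - 0#) * y   ≈⟨ solve 3 (λ x y z → z :* (x :- con (+ 0)) :* y := z :* (x :* y)) refl x y z ⟩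
      z * (x * y)        ≈⟨ *-congˡ xy≈0 ⟩
      z * 0#             ≈⟨ zeroʳ z ⟩
      0#                 ∎

  -- `x ≉ 0` provides no inverse of `x`. But if `y` were apart from 0 it could be cancelled instead,
  -- giving `x ≈ 0`; so `y` is not apart from 0, and tightness applies.
  nonzero-cancel : ∀ {x y} → ¬ (x ≈ 0#) → x * y ≈ 0# → y ≈ 0#
  nonzero-cancel {x} {y} x≉0 xy≈0 = proj₁ (tight _ _) λ y#0 →
    x≉0 (apart-cancel y#0 (trans (*-comm y x) xy≈0))

-- Order, roots and the Archimedean property in the real field

module Reals (R : CompleteOrderedField) where
  open RealOps R
  private
    module R = CompleteOrderedField R
    ring≈ : CommutativeRing 0ℓ 0ℓ
    ring≈ = commutativeRingOf heytingField
  open DecTotalOrder decTotalOrder public using (antisym; total; _≤?_)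
    renaming (refl to ≤-refl; trans to ≤-trans; reflexive to ≤-reflexive; ≤-respˡ-≈ to ≤-respˡ; ≤-respʳ-≈ to ≤-respʳ)

  open Max totalOrder using (⊔-lub)
  open HeytingFields heytingField public
  open IntegerPolynomials ring≈ using (module Solver)
  open Solver using (solve; con; _:+_; _:*_; :-_; _:-_; _:=_)

  two : Carrier
  two = 1# + 1#

  x≤y⇒0≤y-x : ∀ {x y} → x ≤ y → 0# ≤ y - x
  x≤y⇒0≤y-x {x} x≤y = ≤-respˡ (-‿inverseʳ x) (R.+-monoˡ-≤ (- x) x≤y)

  0≤y-x⇒x≤y : ∀ {x y} → 0# ≤ y - x → x ≤ y
  0≤y-x⇒x≤y {x} {y} p = ≤-respˡ (+-identityˡ x)
    (≤-respʳ (solve 2 (λ x y → y :- x :+ x := y) refl x y) (R.+-monoˡ-≤ x p))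

  +-monoʳ-≤ : ∀ z {x y} → x ≤ y → z + x ≤ z + y
  +-monoʳ-≤ z x≤y = ≤-respˡ (+-comm _ _) (≤-respʳ (+-comm _ _) (R.+-monoˡ-≤ z x≤y))

  +-mono-≤ : ∀ {x y u v} → x ≤ y → u ≤ v → x + u ≤ y + v
  +-mono-≤ x≤y u≤v = ≤-trans (R.+-monoˡ-≤ _ x≤y) (+-monoʳ-≤ _ u≤v)

  +-nonNeg : ∀ {x y} → 0# ≤ x → 0# ≤ y → 0# ≤ x + y
  +-nonNeg p q = ≤-respˡ (+-identityˡ 0#) (+-mono-≤ p q)

  *-monoʳ-≤ : ∀ {z x y} → 0# ≤ z → x ≤ y → z * x ≤ z * y
  *-monoʳ-≤ {z} {x} {y} 0≤z x≤y = 0≤y-x⇒x≤y (≤-respʳ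
    (solve 3 (λ x y z → z :* (y :- x) := z :* y :- z :* x) refl x y z)
    (R.*-nonNeg 0≤z (x≤y⇒0≤y-x x≤y)))

  *-monoˡ-≤ : ∀ {z x y} → 0# ≤ z → x ≤ y → x * z ≤ y * z
  *-monoˡ-≤ 0≤z x≤y = ≤-respˡ (*-comm _ _) (≤-respʳ (*-comm _ _) (*-monoʳ-≤ 0≤z x≤y))

  *-mono-≤ : ∀ {x y u v} → 0# ≤ u → 0# ≤ y → x ≤ y → u ≤ v → x * u ≤ y * v
  *-mono-≤ 0≤u 0≤y x≤y u≤v = ≤-trans (*-monoˡ-≤ 0≤u x≤y) (*-monoʳ-≤ 0≤y u≤v)

  square-nonNeg : ∀ x → 0# ≤ x * x
  square-nonNeg x with total 0# x
  ... | inj₁ 0≤x = R.*-nonNeg 0≤x 0≤x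
  ... | inj₂ x≤0 = ≤-respʳ (solve 1 (λ x → (con (+ 0) :- x) :* (con (+ 0) :- x) := x :* x) refl x)
    (R.*-nonNeg (x≤y⇒0≤y-x x≤0) (x≤y⇒0≤y-x x≤0))

  0≤1 : 0# ≤ 1#
  0≤1 = ≤-respʳ (*-identityˡ 1#) (square-nonNeg 1#)

  1≰0 : ¬ (1# ≤ 0#)
  1≰0 1≤0 = 1≉0 (antisym 1≤0 0≤1)

  0≤two : 0# ≤ two
  0≤two = +-nonNeg 0≤1 0≤1

  1≤two : 1# ≤ two
  1≤two = ≤-respˡ (+-identityʳ 1#) (+-monoʳ-≤ 1# 0≤1)

  square-zero : ∀ {x} → x * x ≈ 0# → x ≈ 0#
  square-zero {x} xx≈0 with x ≟ 0#
  ... | yes x≈0 = x≈0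
  ... | no  x≉0 = nonzero-cancel x≉0 xx≈0

  *-⁻¹ : ∀ {x} → ¬ (x ≈ 0#) → x * x ⁻¹ ≈ 1#
  *-⁻¹ {x} x≉0 with x ≟ 0#
  ... | yes x≈0 = contradiction x≈0 x≉0
  ... | no  x≉0 with HeytingField.#⇒invertible heytingField x≉0
  ...   | y , y[x-0]≈1 , _ =
    trans (solve 2 (λ x y → x :* y := y :* (x :- con (+ 0))) refl x y) y[x-0]≈1

  -- The inverse equals `x` times its own square.
  ⁻¹-nonNeg : ∀ {x} → 0# ≤ x → ¬ (x ≈ 0#) → 0# ≤ x ⁻¹
  ⁻¹-nonNeg {x} 0≤x x≉0 = ≤-respʳ
    (trans (sym (*-assoc x (x ⁻¹) (x ⁻¹))) (trans (*-congʳ (*-⁻¹ x≉0)) (*-identityˡ _)))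
    (R.*-nonNeg 0≤x (square-nonNeg (x ⁻¹)))

  square-cancel-≤ : ∀ {u v} → 0# ≤ v → u * u ≤ v * v → u ≤ v
  square-cancel-≤ {u} {v} 0≤v uu≤vv with total u v
  ... | inj₁ u≤v = u≤v
  -- Here v² - u² and 2v (u - v) are both nonnegative, and their sum is - (u - v)²; hence u = v.
  ... | inj₂ v≤u = ≤-reflexive (trans
    (solve 2 (λ u v → u := v :+ (u :- v)) refl u v)
    (trans (+-congˡ (square-zero (antisym
      (0≤y-x⇒x≤y (≤-respʳ
        (solve 2 (λ u v → (v :* v :- u :* u) :+ ((v :* (u :- v)) :+ (v :* (u :- v)))
                          := con (+ 0) :- (u :- v) :* (u :- v)) refl u v)
        (+-nonNeg (x≤y⇒0≤y-x uu≤vv) (+-nonNeg pos pos))))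
      (square-nonNeg (u - v)))))
    (+-identityʳ v)))
    where
    pos : 0# ≤ v * (u - v)
    pos = R.*-nonNeg 0≤v (x≤y⇒0≤y-x v≤u)

  ^-nonNeg : ∀ {x} n → 0# ≤ x → 0# ≤ x ^ n
  ^-nonNeg zero    0≤x = 0≤1
  ^-nonNeg (suc n) 0≤x = R.*-nonNeg 0≤x (^-nonNeg n 0≤x)

  1≤^ : ∀ {x} n → 1# ≤ x → 1# ≤ x ^ n
  1≤^ zero    1≤x = ≤-refl
  1≤^ (suc n) 1≤x = ≤-respˡ (*-identityˡ 1#) (*-mono-≤ 0≤1 (≤-trans 0≤1 1≤x) 1≤x (1≤^ n 1≤x))

  ^≤1 : ∀ {x} n → 0# ≤ x → x ≤ 1# → x ^ n ≤ 1#
  ^≤1 zero    0≤x x≤1 = ≤-refl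
  ^≤1 (suc n) 0≤x x≤1 = ≤-respʳ (*-identityˡ 1#) (*-mono-≤ (^-nonNeg n 0≤x) 0≤1 x≤1 (^≤1 n 0≤x x≤1))

  product-nonNeg : ∀ {n} {v : Vector Carrier n} → (∀ k → 0# ≤ v k) → 0# ≤ product v
  product-nonNeg {zero}  0≤v = 0≤1
  product-nonNeg {suc n} 0≤v = R.*-nonNeg (0≤v zero) (product-nonNeg (0≤v ∘ suc))

  product-mono-≤ : ∀ {n} {u v : Vector Carrier n} → (∀ k → 0# ≤ u k) → (∀ k → u k ≤ v k) →
                   product u ≤ product v
  product-mono-≤ {zero}  0≤u u≤v = ≤-refl
  product-mono-≤ {suc n} 0≤u u≤v = *-mono-≤ (product-nonNeg (0≤u ∘ suc)) (≤-trans (0≤u zero) (u≤v zero))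
    (u≤v zero) (product-mono-≤ (0≤u ∘ suc) (u≤v ∘ suc))

  sum-mono-≤ : ∀ {n} {u v : Vector Carrier n} → (∀ k → u k ≤ v k) → sum u ≤ sum v
  sum-mono-≤ {zero}  u≤v = ≤-refl
  sum-mono-≤ {suc n} u≤v = +-mono-≤ (u≤v zero) (sum-mono-≤ (u≤v ∘ suc))

  ≤maximum : ∀ {n} (v : Vector Carrier n) k → v k ≤ maximum v
  ≤maximum v zero    = x≤x⊔y _ _
  ≤maximum v (suc k) = ≤-trans (≤maximum (v ∘ suc) k) (x≤y⊔x _ _)

  maximum-nonNeg : ∀ {n} (v : Vector Carrier n) → 0# ≤ maximum v
  maximum-nonNeg {zero}  v = ≤-refl
  maximum-nonNeg {suc n} v = ≤-trans (maximum-nonNeg (v ∘ suc)) (x≤y⊔x _ _)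

  maximum-lub : ∀ {n} {v : Vector Carrier n} {b} → 0# ≤ b → (∀ k → v k ≤ b) → maximum v ≤ b
  maximum-lub {zero}  0≤b v≤b = 0≤b
  maximum-lub {suc n} 0≤b v≤b = ⊔-lub (v≤b zero) (maximum-lub 0≤b (v≤b ∘ suc))

  private
    -- A named copy of the predicate local to `root`, so that the two supremum properties can be
    -- stated outside that definition.
    IsRootCandidate : ℕ → Carrier → Carrier → Set
    IsRootCandidate n x t = t ≈ 0# ⊎ (0# ≤ t × t ≤ (1# ⊔ x) × (t ^ n) ≤ x)

    root-supremum : ∀ n x → (∀ t → IsRootCandidate n x t → t ≤ root n x) ×
                            (∀ u → (∀ t → IsRootCandidate n x t → t ≤ u) → root n x ≤ u)
    root-supremum n x = proj₂ (R.supremum _ _ _)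

  root-nonNeg : ∀ n x → 0# ≤ root n x
  root-nonNeg n x = proj₁ (root-supremum n x) 0# (inj₁ refl)

  ≤root : ∀ n {x t} → 0# ≤ t → t ^ suc n ≤ x → t ≤ root (suc n) x
  ≤root n {x} {t} 0≤t tⁿ≤x = proj₁ (root-supremum (suc n) x) t (inj₂ (0≤t , bound , tⁿ≤x))
    where
    bound : t ≤ 1# ⊔ x
    -- The cap `1# ⊔ x` built into `root` excludes no such t: if t ≥ 1, then t is at most its power
    -- with exponent `suc n`, hence at most x.
    bound with total t 1#
    ... | inj₁ t≤1 = ≤-trans t≤1 (x≤x⊔y _ _)
    ... | inj₂ 1≤t = ≤-trans (≤-trans
      (≤-respˡ (*-identityʳ t) (*-monoʳ-≤ 0≤t (1≤^ n 1≤t))) tⁿ≤x) (x≤y⊔x _ _)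

  private
    ^2≈ : ∀ t → t ^ 2 ≈ t * t
    ^2≈ t = *-congˡ (*-identityʳ t)

    -- For s = root 2 x ≠ 0 the number (s² + x) / 2s bounds every t with t² ≤ x, since (s − t)² ≥ 0.
    root²≤ : ∀ {x} → 0# ≤ x → root 2 x * root 2 x ≤ x
    root²≤ {x} 0≤x with root 2 x ≟ 0#
    ... | yes s≈0 = ≤-respˡ (sym (trans (*-congʳ s≈0) (zeroˡ _))) 0≤x
    -- As the least upper bound, s is at most u; multiplied by 2s this reads 2s² ≤ s² + x.
    ... | no  s≉0 = 0≤y-x⇒x≤y (≤-respʳ simplify (R.*-nonNeg 0≤2s (x≤y⇒0≤y-x s≤u)))
      where
      s = root 2 x
      0≤s = root-nonNeg 2 x
      2s = s + s
      0≤2s = +-nonNeg 0≤s 0≤s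
      2s≉0 : ¬ (2s ≈ 0#)
      2s≉0 2s≈0 = s≉0 (antisym (≤-respʳ 2s≈0 (≤-respˡ (+-identityʳ s) (+-monoʳ-≤ s 0≤s))) 0≤s)
      u = (s * s + x) * 2s ⁻¹
      2su : 2s * u ≈ s * s + x
      2su = trans (solve 3 (λ a p q → a :* (p :* q) := p :* (a :* q)) refl 2s (s * s + x) (2s ⁻¹))
        (trans (*-congˡ (*-⁻¹ 2s≉0)) (*-identityʳ _))
      simplify : 2s * (u - s) ≈ x - s * s
      simplify = trans (solve 3 (λ a u s → a :* (u :- s) := a :* u :- a :* s) refl 2s u s)
        (trans (+-congʳ 2su) (solve 2 (λ s x → (s :* s :+ x) :- (s :+ s) :* s := x :- s :* s) refl s x))
      0≤u : 0# ≤ u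
      0≤u = R.*-nonNeg (+-nonNeg (square-nonNeg s) 0≤x) (⁻¹-nonNeg 0≤2s 2s≉0)
      candidate≤u : ∀ t → IsRootCandidate 2 x t → t ≤ u
      candidate≤u t (inj₁ t≈0) = ≤-respˡ (sym t≈0) 0≤u
      candidate≤u t (inj₂ (0≤t , _ , t²≤x)) = 0≤y-x⇒x≤y (≤-respʳ
        (trans (solve 4 (λ s x t h → h :* (s :* s :+ x :- (s :+ s) :* t)
                                     := (s :* s :+ x) :* h :- (s :+ s) :* h :* t) refl s x t (2s ⁻¹))
          (+-congˡ (-‿cong (trans (*-congʳ (*-⁻¹ 2s≉0)) (*-identityˡ t)))))
        (R.*-nonNeg (⁻¹-nonNeg 0≤2s 2s≉0) (≤-respʳ
          (solve 3 (λ s x t → (s :- t) :* (s :- t) :+ (x :- t :* t) := s :* s :+ x :- (s :+ s) :* t) refl s x t)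
          (+-nonNeg (square-nonNeg (s - t)) (x≤y⇒0≤y-x (≤-respˡ (^2≈ t) t²≤x))))))
      s≤u : s ≤ u
      s≤u = proj₂ (root-supremum 2 x) u candidate≤u

    -- For s² < x the number s + d / (1 + 2s + d) with d = x − s² would be a larger candidate.
    ≤root² : ∀ {x} → 0# ≤ x → x ≤ root 2 x * root 2 x
    ≤root² {x} 0≤x with total x (root 2 x * root 2 x)
    ... | inj₁ x≤s² = x≤s²
    ... | inj₂ s²≤x = ≤-reflexive (trans
      (solve 2 (λ s x → x := s :* s :+ (x :- s :* s)) refl s x) (trans (+-congˡ d≈0) (+-identityʳ _)))
      where
      s = root 2 x
      0≤s = root-nonNeg 2 x
      d = x - s * s
      0≤d = x≤y⇒0≤y-x s²≤x
      D = 1# + (s + s) + d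
      0≤1+2s = +-nonNeg 0≤1 (+-nonNeg 0≤s 0≤s)
      1≤D : 1# ≤ D
      1≤D = 0≤y-x⇒x≤y (≤-respʳ
        (solve 2 (λ s d → (s :+ s) :+ d := con (+ 1) :+ (s :+ s) :+ d :- con (+ 1)) refl s d)
        (+-nonNeg (+-nonNeg 0≤s 0≤s) 0≤d))
      D≉0 : ¬ (D ≈ 0#)
      D≉0 D≈0 = 1≰0 (≤-respʳ D≈0 1≤D)
      0≤D⁻¹ = ⁻¹-nonNeg (≤-trans 0≤1 1≤D) D≉0
      δ = d * D ⁻¹
      0≤δ = R.*-nonNeg 0≤d 0≤D⁻¹
      Dδ : D * δ ≈ d
      Dδ = trans (solve 3 (λ a p q → a :* (p :* q) := p :* (a :* q)) refl D d (D ⁻¹))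
        (trans (*-congˡ (*-⁻¹ D≉0)) (*-identityʳ d))
      0≤1-δ : 0# ≤ 1# - δ
      0≤1-δ = ≤-respʳ
        (trans (solve 3 (λ s d h → h :* (con (+ 1) :+ (s :+ s))
                                   := (con (+ 1) :+ (s :+ s) :+ d) :* h :- d :* h) refl s d (D ⁻¹))
          (+-congʳ (*-⁻¹ D≉0)))
        (R.*-nonNeg 0≤D⁻¹ 0≤1+2s)
      t = s + δ
      t²≤x : t * t ≤ x
      -- Because D δ = d = x - s², the gap x - t² equals δ (d + 1 - δ), and δ ≤ 1. So t = s + δ is a
      -- candidate, which forces δ = 0 and with it d = 0.
      t²≤x = 0≤y-x⇒x≤y (≤-respʳ
        (trans (solve 3 (λ s d δ → δ :* (d :+ (con (+ 1) :- δ))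
                 := s :* s :+ (con (+ 1) :+ (s :+ s) :+ d) :* δ :- (s :+ δ) :* (s :+ δ)) refl s d δ)
          (+-congʳ (trans (+-congˡ Dδ) (solve 2 (λ s x → s :* s :+ (x :- s :* s) := x) refl s x))))
        (R.*-nonNeg 0≤δ (+-nonNeg 0≤d 0≤1-δ)))
      δ≈0 : δ ≈ 0#
      δ≈0 = antisym
        (0≤y-x⇒x≤y (≤-respʳ (solve 2 (λ s δ → s :- (s :+ δ) := con (+ 0) :- δ) refl s δ)
          (x≤y⇒0≤y-x (≤root 1 (+-nonNeg 0≤s 0≤δ) (≤-respˡ (sym (^2≈ t)) t²≤x)))))
        0≤δ
      d≈0 : d ≈ 0#
      d≈0 = trans (sym Dδ) (trans (*-congˡ δ≈0) (zeroʳ D))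

  root² : ∀ {x} → 0# ≤ x → root 2 x * root 2 x ≈ x
  root² 0≤x = antisym (root²≤ 0≤x) (≤root² 0≤x)

  -- If the powers t had a supremum s, then 2t ≤ s and t ≥ 1 would give t ≤ s - t ≤ s - 1, so s - 1
  -- would bound them too.
  two^-unbounded : ∀ b → ¬ (∀ k → two ^ k ≤ b)
  two^-unbounded b bounded with R.supremum (λ t → ∃ λ k → t ≈ two ^ k) (1# , 0 , refl)
    (b , λ t (k , t≈) → ≤-respˡ (sym t≈) (bounded k))
  ... | s , upper , least = 1≰0 (0≤y-x⇒x≤y (≤-respʳ
    (solve 1 (λ s → (s :- con (+ 1)) :- s := con (+ 0) :- con (+ 1)) refl s)
    (x≤y⇒0≤y-x (least (s - 1#) smaller))))
    where
    smaller : ∀ t → (∃ λ k → t ≈ two ^ k) → t ≤ s - 1#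
    smaller t (k , t≈) = 0≤y-x⇒x≤y (≤-respʳ
      (solve 2 (λ s t → (s :- (con (+ 1) :+ con (+ 1)) :* t) :+ (t :- con (+ 1)) := (s :- con (+ 1)) :- t) refl s t)
      (+-nonNeg (x≤y⇒0≤y-x (upper (two * t) (suc k , *-congˡ t≈)))
        (x≤y⇒0≤y-x (≤-respʳ (sym t≈) (1≤^ k 1≤two)))))

-- Complex numbers, the modulus, and factorization of the homogeneous form

module Complexes (R : CompleteOrderedField) where
  open RealOps R
  open Reals R
  private
    module R = CompleteOrderedField R
    module ℝ = IntegerPolynomials (commutativeRingOf heytingField)
  open ℝ.Solver using (solve; con; _:+_; _:*_; :-_; _:-_; _:=_)

  complexRing : CommutativeRing 0ℓ 0ℓ
  complexRing = record
    { Carrier = ℂ.Carrier ; _≈_ = ℂ._≈_ ; _+_ = ℂ._+_ ; _*_ = ℂ._*_ ; -_ = ℂ.-_ ; 0# = ℂ.0# ; 1# = ℂ.1#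
    ; isCommutativeRing = record
      { isRing = record
        { +-isAbelianGroup = record
          { isGroup = record
            { isMonoid = record
              { isSemigroup = record
                { isMagma = record
                  { isEquivalence = record
                    { refl  = refl , refl
                    ; sym   = λ (p , q) → sym p , sym q
                    ; trans = λ (p , q) (r , s) → trans p r , trans q s
                    }
                  ; ∙-cong = λ (p , q) (r , s) → +-cong p r , +-cong q s
                  }
                ; assoc = λ _ _ _ → +-assoc _ _ _ , +-assoc _ _ _
                }
              ; identity = (λ _ → +-identityˡ _ , +-identityˡ _) , (λ _ → +-identityʳ _ , +-identityʳ _)
              }
            ; inverse = (λ _ → -‿inverseˡ _ , -‿inverseˡ _) , (λ _ → -‿inverseʳ _ , -‿inverseʳ _)
            ; ⁻¹-cong = λ (p , q) → -‿cong p , -‿cong q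
            }
          ; comm = λ _ _ → +-comm _ _ , +-comm _ _
          }
        ; *-cong = λ (p , q) (r , s) →
            +-cong (*-cong p r) (-‿cong (*-cong q s)) , +-cong (*-cong p s) (*-cong q r)
        ; *-assoc = λ (a , b) (c , d) (e , f) →
            solve 6 (λ a b c d e f → (a :* c :- b :* d) :* e :- (a :* d :+ b :* c) :* f
              := a :* (c :* e :- d :* f) :- b :* (c :* f :+ d :* e)) refl a b c d e f ,
            solve 6 (λ a b c d e f → (a :* c :- b :* d) :* f :+ (a :* d :+ b :* c) :* e
              := a :* (c :* f :+ d :* e) :+ b :* (c :* e :- d :* f)) refl a b c d e f
        ; *-identity =
            (λ (a , b) → solve 2 (λ a b → con (+ 1) :* a :- con (+ 0) :* b := a) refl a b ,
                         solve 2 (λ a b → con (+ 1) :* b :+ con (+ 0) :* a := b) refl a b) ,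
            (λ (a , b) → solve 2 (λ a b → a :* con (+ 1) :- b :* con (+ 0) := a) refl a b ,
                         solve 2 (λ a b → a :* con (+ 0) :+ b :* con (+ 1) := b) refl a b)
        ; distrib =
            (λ (a , b) (c , d) (e , f) →
              solve 6 (λ a b c d e f → a :* (c :+ e) :- b :* (d :+ f)
                := (a :* c :- b :* d) :+ (a :* e :- b :* f)) refl a b c d e f ,
              solve 6 (λ a b c d e f → a :* (d :+ f) :+ b :* (c :+ e)
                := (a :* d :+ b :* c) :+ (a :* f :+ b :* e)) refl a b c d e f) ,
            (λ (a , b) (c , d) (e , f) →
              solve 6 (λ a b c d e f → (c :+ e) :* a :- (d :+ f) :* b
                := (c :* a :- d :* b) :+ (e :* a :- f :* b)) refl a b c d e f ,
              solve 6 (λ a b c d e f → (c :+ e) :* b :+ (d :+ f) :* a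
                := (c :* b :+ d :* a) :+ (e :* b :+ f :* a)) refl a b c d e f)
        }
      ; *-comm = λ (a , b) (c , d) →
          solve 4 (λ a b c d → a :* c :- b :* d := c :* a :- d :* b) refl a b c d ,
          solve 4 (λ a b c d → a :* d :+ b :* c := c :* b :+ d :* a) refl a b c d
      }
    }

  private
    module C = CommutativeRing complexRing

    normSq : ℂ.Carrier → Carrier
    normSq (a , b) = a * a + b * b

    normSq-nonNeg : ∀ z → 0# ≤ normSq z
    normSq-nonNeg (a , b) = +-nonNeg (square-nonNeg a) (square-nonNeg b)

  ∣_∣-nonNeg : ∀ z → 0# ≤ ∣ z ∣
  ∣ z ∣-nonNeg = root-nonNeg 2 (normSq z)

  ∣_∣² : ∀ z → ∣ z ∣ * ∣ z ∣ ≈ normSq z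
  ∣ z ∣² = root² (normSq-nonNeg z)

  square-injective : ∀ {u v} → 0# ≤ u → 0# ≤ v → u * u ≈ v * v → u ≈ v
  square-injective 0≤u 0≤v uu≈vv =
    antisym (square-cancel-≤ 0≤v (≤-reflexive uu≈vv)) (square-cancel-≤ 0≤u (≤-reflexive (sym uu≈vv)))

  ∣∣-cong : ∀ {z w} → z ℂ.≈ w → ∣ z ∣ ≈ ∣ w ∣
  ∣∣-cong {z} {w} (p , q) = square-injective ∣ z ∣-nonNeg ∣ w ∣-nonNeg
    (trans ∣ z ∣² (trans (+-cong (*-cong p p) (*-cong q q)) (sym ∣ w ∣²)))

  -- The two-square identity of Brahmagupta and Fibonacci, compared through squares of nonnegative
  -- numbers.
  ∣zw∣≈∣z∣∣w∣ : ∀ z w → ∣ z ℂ.* w ∣ ≈ ∣ z ∣ * ∣ w ∣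
  ∣zw∣≈∣z∣∣w∣ z@(a , b) w@(c , d) =
    square-injective ∣ z ℂ.* w ∣-nonNeg (R.*-nonNeg ∣ z ∣-nonNeg ∣ w ∣-nonNeg)
      (trans ∣ z ℂ.* w ∣² (trans
        (solve 4 (λ a b c d → (a :* c :- b :* d) :* (a :* c :- b :* d) :+ (a :* d :+ b :* c) :* (a :* d :+ b :* c)
          := (a :* a :+ b :* b) :* (c :* c :+ d :* d)) refl a b c d)
        (trans (*-cong (sym ∣ z ∣²) (sym ∣ w ∣²))
          (solve 2 (λ u v → (u :* u) :* (v :* v) := (u :* v) :* (u :* v)) refl ∣ z ∣ ∣ w ∣))))

  ∣z+w∣≤∣z∣+∣w∣ : ∀ z w → ∣ z ℂ.+ w ∣ ≤ ∣ z ∣ + ∣ w ∣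
  ∣z+w∣≤∣z∣+∣w∣ z@(a , b) w@(c , d) =
    square-cancel-≤ (+-nonNeg ∣ z ∣-nonNeg ∣ w ∣-nonNeg)
      (≤-respˡ (sym (trans ∣ z ℂ.+ w ∣²
        (solve 4 (λ a b c d → (a :+ c) :* (a :+ c) :+ (b :+ d) :* (b :+ d)
          := ((a :* a :+ b :* b) :+ (c :* c :+ d :* d)) :+ ((a :* c :+ b :* d) :+ (a :* c :+ b :* d)))
          refl a b c d)))
      (≤-respʳ (trans (+-congʳ (+-cong (sym ∣ z ∣²) (sym ∣ w ∣²)))
          (solve 2 (λ u v → (u :* u :+ v :* v) :+ (u :* v :+ u :* v) := (u :+ v) :* (u :+ v)) refl ∣ z ∣ ∣ w ∣))
        (+-monoʳ-≤ _ (+-mono-≤ inner≤ inner≤))))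
    where
    inner≤ : a * c + b * d ≤ ∣ z ∣ * ∣ w ∣
    -- Cauchy-Schwarz in the plane: by Lagrange's identity |z|² |w|² - (ac + bd)² is the square of
    -- ad - bc.
    inner≤ = square-cancel-≤ (R.*-nonNeg ∣ z ∣-nonNeg ∣ w ∣-nonNeg) (0≤y-x⇒x≤y (≤-respʳ
      (trans (solve 4 (λ a b c d → (a :* d :- b :* c) :* (a :* d :- b :* c)
          := (a :* a :+ b :* b) :* (c :* c :+ d :* d) :- (a :* c :+ b :* d) :* (a :* c :+ b :* d)) refl a b c d)
        (+-congʳ (trans (*-cong (sym ∣ z ∣²) (sym ∣ w ∣²))
          (solve 2 (λ u v → (u :* u) :* (v :* v) := (u :* v) :* (u :* v)) refl ∣ z ∣ ∣ w ∣))))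
      (square-nonNeg (a * d - b * c))))

  ∣-z∣≈∣z∣ : ∀ z → ∣ ℂ.- z ∣ ≈ ∣ z ∣
  ∣-z∣≈∣z∣ z@(a , b) = square-injective ∣ ℂ.- z ∣-nonNeg ∣ z ∣-nonNeg
    (trans ∣ ℂ.- z ∣² (trans
      (solve 2 (λ a b → (:- a) :* (:- a) :+ (:- b) :* (:- b) := a :* a :+ b :* b) refl a b) (sym ∣ z ∣²)))

  ∣x∣≈x : ∀ {x} → 0# ≤ x → ∣ (x , 0#) ∣ ≈ x
  ∣x∣≈x {x} 0≤x = square-injective ∣ (x , 0#) ∣-nonNeg 0≤x
    (trans ∣ (x , 0#) ∣² (solve 1 (λ x → x :* x :+ con (+ 0) :* con (+ 0) := x :* x) refl x))

  ∣1∣≈1 : ∣ ℂ.1# ∣ ≈ 1#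
  ∣1∣≈1 = ∣x∣≈x 0≤1

  ∣∑∣≤∑∣∣ : ∀ {n} (v : Vector ℂ.Carrier n) → ∣ ℂ.sum v ∣ ≤ sum (λ k → ∣ v k ∣)
  ∣∑∣≤∑∣∣ {zero}  v = ≤-reflexive (∣x∣≈x ≤-refl)
  ∣∑∣≤∑∣∣ {suc n} v = ≤-trans (∣z+w∣≤∣z∣+∣w∣ (v zero) (ℂ.sum (v ∘ suc))) (+-monoʳ-≤ _ (∣∑∣≤∑∣∣ (v ∘ suc)))

  ∣∏∣≈∏∣∣ : ∀ {n} (v : Vector ℂ.Carrier n) → ∣ ℂ.product v ∣ ≈ product (λ k → ∣ v k ∣)
  ∣∏∣≈∏∣∣ {zero}  v = ∣1∣≈1
  ∣∏∣≈∏∣∣ {suc n} v = trans (∣zw∣≈∣z∣∣w∣ (v zero) (ℂ.product (v ∘ suc))) (*-congˡ (∣∏∣≈∏∣∣ (v ∘ suc)))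

  private
    n·1 : ∀ n → n ℂ.· ℂ.1# ℂ.≈ (n · 1# , 0#)
    n·1 zero    = refl , refl
    n·1 (suc n) = +-congˡ (proj₁ (n·1 n)) , trans (+-congˡ (proj₂ (n·1 n))) (+-identityˡ 0#)

  ·1-mono-≤ : ∀ {m n} → m ℕ.≤ n → m · 1# ≤ n · 1#
  ·1-mono-≤ {n = zero}  z≤n       = ≤-refl
  ·1-mono-≤ {n = suc n} z≤n       = +-nonNeg 0≤1 (·1-mono-≤ {n = n} z≤n)
  ·1-mono-≤             (s≤s m≤n) = +-monoʳ-≤ 1# (·1-mono-≤ m≤n)

  ∣fromℤ∣ : ∀ i → ∣ ℂ.fromℤ i ∣ ≈ ℤ.∣ i ∣ · 1#
  ∣fromℤ∣ (+ n)    = trans (∣∣-cong (n·1 n)) (∣x∣≈x (·1-mono-≤ {n = n} z≤n))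
  ∣fromℤ∣ -[1+ n ] = trans (∣-z∣≈∣z∣ (suc n ℂ.· ℂ.1#)) (∣fromℤ∣ (+ suc n))

  _≟ᶜ0 : ∀ z → Dec (z ℂ.≈ ℂ.0#)
  (a , b) ≟ᶜ0 = (a ≟ 0#) ×-dec (b ≟ 0#)

  ℂ-inverse : ∀ {z} → ¬ (z ℂ.≈ ℂ.0#) → ∃ λ w → w ℂ.* z ℂ.≈ ℂ.1#
  ℂ-inverse {a , b} z≉0 = (a * N ⁻¹ , - b * N ⁻¹) ,
    trans (solve 3 (λ a b h → a :* h :* a :- (:- b) :* h :* b := (a :* a :+ b :* b) :* h) refl a b (N ⁻¹)) (*-⁻¹ N≉0) ,
    solve 3 (λ a b h → a :* h :* b :+ (:- b) :* h :* a := con (+ 0)) refl a b (N ⁻¹)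
    where
    N = a * a + b * b
    summand≈0 : ∀ {u v} → 0# ≤ u → 0# ≤ v → u + v ≈ 0# → u ≈ 0#
    summand≈0 {u} {v} 0≤u 0≤v u+v≈0 = antisym (≤-respʳ u+v≈0 (≤-respˡ (+-identityʳ u) (+-monoʳ-≤ u 0≤v))) 0≤u
    N≉0 : ¬ (N ≈ 0#)
    N≉0 N≈0 = z≉0
      ( square-zero (summand≈0 (square-nonNeg a) (square-nonNeg b) N≈0)
      , square-zero (summand≈0 (square-nonNeg b) (square-nonNeg a) (trans (+-comm _ _) N≈0)))

  private module D = Determinants complexRing

  -- For Y ≠ 0 the factorization is evaluated at z = X/Y and each of the n factors is multiplied by
  -- Y. For Y = 0 this division is impossible, but both sides reduce to Xⁿ.
  homogenize-factors : ∀ {n} (f r : Vector ℂ.Carrier n) →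
    (∀ z → ℂ.monic f z ℂ.≈ ℂ.product (λ k → z ℂ.+ (ℂ.- r k))) →
    ∀ X Y → D.homogenize f X Y ℂ.≈ ℂ.product (λ k → X ℂ.+ (ℂ.- (r k ℂ.* Y)))
  homogenize-factors {n} f r factors X Y with Y ≟ᶜ0
  ... | yes Y≈0 = begin
    D.homogenize f X Y                              ≈⟨ D.homogenize-zero f X Y≈0 ⟩
    X ℂ.^ n                                         ≈⟨ C.sym (D.product-constant n X) ⟩
    ℂ.product {n} (λ _ → X)                         ≈⟨ D.product-cong {n} (λ k → C.trans
        (ℂsolve 2 (λ X r → X :=ᶜ X :-ᶜ r :*ᶜ conᶜ (+ 0)) C.refl X (r k))
        (C.+-congˡ (C.-‿cong (C.*-congˡ (C.sym Y≈0))))) ⟩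
    ℂ.product (λ k → X ℂ.+ (ℂ.- (r k ℂ.* Y)))       ∎
    where
    open SetoidReasoning C.setoid
    open IntegerPolynomials.Solver complexRing using ()
      renaming (solve to ℂsolve; _:=_ to _:=ᶜ_; _:-_ to _:-ᶜ_; _:*_ to _:*ᶜ_; con to conᶜ)
  ... | no Y≉0 with ℂ-inverse Y≉0
  ...   | w , wY≈1 = begin
    D.homogenize f X Y                              ≈⟨ D.homogenize-cong f X≈ C.refl ⟩
    D.homogenize f (z ℂ.* Y) Y                      ≈⟨ D.homogenize-monic f z Y ⟩
    Y ℂ.^ n ℂ.* ℂ.monic f z                         ≈⟨ C.*-congˡ (factors z) ⟩
    Y ℂ.^ n ℂ.* ℂ.product (λ k → z ℂ.+ (ℂ.- r k))   ≈⟨ C.sym (D.product-scale Y (λ k → z ℂ.+ (ℂ.- r k))) ⟩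
    ℂ.product (λ k → Y ℂ.* (z ℂ.+ (ℂ.- r k)))       ≈⟨ D.product-cong {n} (λ k → C.trans
        (ℂsolve 3 (λ Y z r → Y :*ᶜ (z :-ᶜ r) :=ᶜ z :*ᶜ Y :-ᶜ r :*ᶜ Y) C.refl Y z (r k))
        (C.+-congʳ (C.sym X≈))) ⟩
    ℂ.product (λ k → X ℂ.+ (ℂ.- (r k ℂ.* Y)))       ∎
    where
    open SetoidReasoning C.setoid
    open IntegerPolynomials.Solver complexRing using ()
      renaming (solve to ℂsolve; _:=_ to _:=ᶜ_; _:-_ to _:-ᶜ_; _:*_ to _:*ᶜ_)
    z = X ℂ.* w
    X≈ : X ℂ.≈ z ℂ.* Y
    X≈ = C.sym (C.trans (C.*-assoc X w Y) (C.trans (C.*-congˡ wY≈1) (C.*-identityʳ X)))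

-- Sums against the identity matrix

module IdentityMatrix {c ℓ : Level} (A : CommutativeRing c ℓ) where
  open CommutativeRing A hiding (zero)
  open RingOps rawRing
  open Determinants A using (sum-zero)

  1ᴹ-sym : ∀ {n} (i j : Fin n) → 1ᴹ i j ≡ 1ᴹ j i
  1ᴹ-sym zero    zero    = ≡.refl
  1ᴹ-sym zero    (suc j) = ≡.refl
  1ᴹ-sym (suc i) zero    = ≡.refl
  1ᴹ-sym (suc i) (suc j) = 1ᴹ-sym i j

  sum-1ᴹʳ : ∀ {n} (i : Fin n) (v : Vector Carrier n) → sum (λ k → 1ᴹ i k * v k) ≈ v i
  sum-1ᴹʳ zero v = trans
    (+-cong (*-identityˡ _) (sum-zero {v = λ k → 0# * v (suc k)} (λ k → zeroˡ _))) (+-identityʳ _)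
  sum-1ᴹʳ (suc i) v = trans (+-cong (zeroˡ _) (sum-1ᴹʳ i (v ∘ suc))) (+-identityˡ _)

  sum-1ᴹˡ : ∀ {n} (j : Fin n) (v : Vector Carrier n) → sum (λ k → 1ᴹ k j * v k) ≈ v j
  sum-1ᴹˡ {n} j v = trans
    (SemiringSum.sum-cong-≋ semiring {n} (λ k → *-congʳ (reflexive (1ᴹ-sym k j)))) (sum-1ᴹʳ j v)

-- Derived operations under a ring homomorphism

module Homomorphism {a b ℓ₁ ℓ₂ : Level} (A : CommutativeRing a ℓ₁) (B : CommutativeRing b ℓ₂)
                    (φ : CommutativeRing.Carrier A → CommutativeRing.Carrier B)
                    (φ-homo : IsRingHomomorphism (CommutativeRing.rawRing A) (CommutativeRing.rawRing B) φ) where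
  open IsRingHomomorphism φ-homo using (+-homo; *-homo; -‿homo; 0#-homo; 1#-homo)
  private
    module A where
      open CommutativeRing A public
      open RingOps rawRing public
  open CommutativeRing B hiding (zero)
  open RingOps rawRing

  sum-homo : ∀ {n} (v : Vector A.Carrier n) → φ (A.sum v) ≈ sum (φ ∘ v)
  sum-homo {zero}  v = 0#-homo
  sum-homo {suc n} v = trans (+-homo _ _) (+-congˡ (sum-homo (v ∘ suc)))

  ^-homo : ∀ x n → φ (x A.^ n) ≈ φ x ^ n
  ^-homo x zero    = 1#-homo
  ^-homo x (suc n) = trans (*-homo _ _) (*-congˡ (^-homo x n))

  ·1-homo : ∀ n → φ (n A.· A.1#) ≈ n · 1#
  ·1-homo zero    = 0#-homo
  ·1-homo (suc n) = trans (+-homo _ _) (+-cong 1#-homo (·1-homo n))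

  fromℤ-homo : ∀ i → φ (A.fromℤ i) ≈ fromℤ i
  fromℤ-homo (+ n)    = ·1-homo n
  fromℤ-homo -[1+ n ] = trans (-‿homo _) (-‿cong (·1-homo (suc n)))

  1ᴹ-homo : ∀ {n} (i j : Fin n) → φ (A.1ᴹ i j) ≈ 1ᴹ i j
  1ᴹ-homo zero    zero    = 1#-homo
  1ᴹ-homo zero    (suc j) = 0#-homo
  1ᴹ-homo (suc i) zero    = 0#-homo
  1ᴹ-homo (suc i) (suc j) = 1ᴹ-homo i j

  homogenize-homo : ∀ {n} (f : Vector A.Carrier n) X Y →
    φ (Determinants.homogenize A f X Y) ≈ Determinants.homogenize B (φ ∘ f) (φ X) (φ Y)
  homogenize-homo {zero}  f X Y = 1#-homo
  homogenize-homo {suc n} f X Y = trans (+-homo _ _) (+-cong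
    (trans (*-homo _ _) (*-congˡ (homogenize-homo (f ∘ suc) X Y)))
    (trans (*-homo _ _) (*-congˡ (^-homo Y (suc n)))))

-- The relative norm of X - αY and the constant term of f

module Extension {c ℓ₁ ℓ₂ c′ ℓ₁′ ℓ₂′ : Level} {n : ℕ} (F : HeytingField c ℓ₁ ℓ₂)
                 (L : SimpleExtension F c′ ℓ₁′ ℓ₂′ (suc n)) where
  private
    module M where
      open CommutativeRing (commutativeRingOf F) public
      open RingOps rawRing public
    module MRing = RingProperties (CommutativeRing.ring (commutativeRingOf F))
  open SimpleExtension L
  private
    ring≈ : CommutativeRing c′ ℓ₁′
    ring≈ = commutativeRingOf heytingField
  open IsRingHomomorphism ι-homo using (+-homo; *-homo; -‿homo; 0#-homo; 1#-homo)
  open Homomorphism (commutativeRingOf F) ring≈ ι ι-homo using (1ᴹ-homo)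
  open IntegerPolynomials ring≈ using (monic-∷; poly-∷; module Solver)
  open Solver using (solve; con; _:+_; _:*_; :-_; _:-_; _:=_)
  open SemiringSum semiring using (sum-cong-≋; *-distribˡ-sum; ∑-distrib-+)
  open RingProperties ring using (+-inverseʳ-unique)
  open SetoidReasoning setoid

  poly-linear : ∀ {d} a b (u v : Vector M.Carrier d) x →
    poly (λ i → ι (a M.* u i M.+ b M.* v i)) x ≈ ι a * poly (ι ∘ u) x + ι b * poly (ι ∘ v) x
  poly-linear a b u v x = begin
    sum (λ i → ι (a M.* u i M.+ b M.* v i) * x ^ toℕ i)
      ≈⟨ sum-cong-≋ (λ i → trans (*-congʳ (trans (+-homo _ _) (+-cong (*-homo _ _) (*-homo _ _))))
           (solve 5 (λ a u b v p → (a :* u :+ b :* v) :* p := a :* (u :* p) :+ b :* (v :* p)) refl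
             (ι a) (ι (u i)) (ι b) (ι (v i)) (x ^ toℕ i))) ⟩
    sum (λ i → ι a * (ι (u i) * x ^ toℕ i) + ι b * (ι (v i) * x ^ toℕ i))
      ≈⟨ ∑-distrib-+ (λ i → ι a * (ι (u i) * x ^ toℕ i)) (λ i → ι b * (ι (v i) * x ^ toℕ i)) ⟩
    sum (λ i → ι a * (ι (u i) * x ^ toℕ i)) + sum (λ i → ι b * (ι (v i) * x ^ toℕ i))
      ≈⟨ +-cong (*-distribˡ-sum (ι a) (λ i → ι (u i) * x ^ toℕ i))
                (*-distribˡ-sum (ι b) (λ i → ι (v i) * x ^ toℕ i)) ⟨
    ι a * poly (ι ∘ u) x + ι b * poly (ι ∘ v) x ∎

  poly-1ᴹ : ∀ {d} (j : Fin d) x → poly (λ i → ι (M.1ᴹ i j)) x ≈ x ^ toℕ j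
  poly-1ᴹ {d} j x = trans (sum-cong-≋ {d} (λ i → *-congʳ (1ᴹ-homo i j)))
    (IdentityMatrix.sum-1ᴹˡ ring≈ j (λ i → x ^ toℕ i))

  open Basis powerBasis using (coord; expand; multMatrix)

  -- `f-minimal` speaks only of relations equal to zero, so it is applied to the difference of the
  -- two coefficient vectors, written with the scalars 1 and - 1 to fit `poly-linear`.
  coord-unique : ∀ {β} (e : Vector M.Carrier (suc n)) → β ≈ poly (ι ∘ e) α → ∀ i → coord β i M.≈ e i
  coord-unique {β} e β≈ i = MRing.x∙y⁻¹≈ε⇒x≈y (coord β i) (e i) (M.trans
    (M.+-cong (M.sym (M.*-identityˡ (coord β i))) (M.sym (MRing.-1*x≈-x (e i))))
    (f-minimal (λ i → M.1# M.* coord β i M.+ (M.- M.1#) M.* e i) difference i))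
    where
    difference : poly (λ i → ι (M.1# M.* coord β i M.+ (M.- M.1#) M.* e i)) α ≈ 0#
    difference = begin
      poly (λ i → ι (M.1# M.* coord β i M.+ (M.- M.1#) M.* e i)) α
        ≈⟨ poly-linear M.1# (M.- M.1#) (coord β) e α ⟩
      ι M.1# * poly (ι ∘ coord β) α + ι (M.- M.1#) * poly (ι ∘ e) α
        ≈⟨ +-cong (*-cong 1#-homo (sym (expand β)))
             (*-cong (trans (-‿homo _) (-‿cong 1#-homo)) (sym β≈)) ⟩
      1# * β + (- 1#) * β
        ≈⟨ solve 1 (λ β → con (+ 1) :* β :+ (:- con (+ 1)) :* β := con (+ 0)) refl β ⟩
      0# ∎

  -- Column j holds the coordinates of (X - αY) αʲ = X αʲ - Y αʲ⁺¹. In the last column the power of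
  -- α leaves the basis, and f(α) = 0 replaces it by minus the lower part of f, whence the entries
  -- `Y * f i`.
  multMatrix-pencil : ∀ X Y →
    Determinants.IsCompanionPencil (commutativeRingOf F) f X Y (multMatrix (ι X - α * ι Y))
  multMatrix-pencil X Y = record { inner = inner ; last = last }
    where
    β = ι X - α * ι Y

    inner : ∀ i j → multMatrix β i (inject₁ j) M.≈ X M.* M.1ᴹ i (inject₁ j) M.- Y M.* M.1ᴹ i (suc j)
    inner i j = M.trans
      (coord-unique (λ i → X M.* M.1ᴹ i (inject₁ j) M.+ (M.- Y) M.* M.1ᴹ i (suc j)) expansion i)
      (M.+-congˡ (M.sym (MRing.-‿distribˡ-* Y (M.1ᴹ i (suc j)))))
      where
      p = α ^ toℕ (inject₁ j)
      expansion : β * p ≈ poly (λ i → ι (X M.* M.1ᴹ i (inject₁ j) M.+ (M.- Y) M.* M.1ᴹ i (suc j))) α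
      expansion = sym (begin
        poly (λ i → ι (X M.* M.1ᴹ i (inject₁ j) M.+ (M.- Y) M.* M.1ᴹ i (suc j))) α
          ≈⟨ poly-linear X (M.- Y) (λ i → M.1ᴹ i (inject₁ j)) (λ i → M.1ᴹ i (suc j)) α ⟩
        ι X * poly (λ i → ι (M.1ᴹ i (inject₁ j))) α + ι (M.- Y) * poly (λ i → ι (M.1ᴹ i (suc j))) α
          ≈⟨ +-cong (*-congˡ (poly-1ᴹ (inject₁ j) α)) (*-cong (-‿homo Y)
               (trans (poly-1ᴹ (suc j) α) (*-congˡ (reflexive (≡.cong (α ^_) (≡.sym (toℕ-inject₁ j))))))) ⟩
        ι X * p + (- ι Y) * (α * p)
          ≈⟨ solve 4 (λ X Y a p → X :* p :+ (:- Y) :* (a :* p) := (X :- a :* Y) :* p) refl (ι X) (ι Y) α p ⟩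
        β * p ∎)

    last : ∀ i → multMatrix β i (fromℕ n) M.≈ X M.* M.1ᴹ i (fromℕ n) M.+ Y M.* f i
    last = coord-unique (λ i → X M.* M.1ᴹ i (fromℕ n) M.+ Y M.* f i) (sym (begin
      poly (λ i → ι (X M.* M.1ᴹ i (fromℕ n) M.+ Y M.* f i)) α
        ≈⟨ poly-linear X Y (λ i → M.1ᴹ i (fromℕ n)) f α ⟩
      ι X * poly (λ i → ι (M.1ᴹ i (fromℕ n))) α + ι Y * poly (ι ∘ f) α
        ≈⟨ +-cong (*-congˡ (poly-1ᴹ (fromℕ n) α)) (*-congˡ poly-f) ⟩
      ι X * p + ι Y * - (α * p)
        ≈⟨ solve 4 (λ X Y a p → X :* p :+ Y :* (:- (a :* p)) := (X :- a :* Y) :* p) refl (ι X) (ι Y) α p ⟩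
      β * p ∎))
      where
      p = α ^ toℕ (fromℕ n)
      poly-f : poly (ι ∘ f) α ≈ - (α * p)
      poly-f = trans (+-inverseʳ-unique (α ^ suc n) (poly (ι ∘ f) α) (trans (+-comm _ _) f-root))
        (-‿cong (*-congˡ (reflexive (≡.cong (α ^_) (≡.sym (toℕ-fromℕ n))))))

  norm-linear : ∀ X Y → norm (ι X - α * ι Y) M.≈ Determinants.homogenize (commutativeRingOf F) f X Y
  norm-linear X Y = Determinants.det-companion (commutativeRingOf F) {U = multMatrix (ι X - α * ι Y)}
    (multMatrix-pencil X Y)

  private
    -- Appends the leading coefficient 1, turning a monic polynomial into the plain coefficient
    -- vector to which `f-minimal` applies.
    snoc : ∀ {d} → Vector M.Carrier d → Vector M.Carrier (suc d)
    snoc {zero}  u = λ _ → M.1#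
    snoc {suc d} u = u zero Vector.∷ snoc (u ∘ suc)

    snoc-last : ∀ {d} (u : Vector M.Carrier d) → snoc u (fromℕ d) ≡ M.1#
    snoc-last {zero}  u = ≡.refl
    snoc-last {suc d} u = snoc-last (u ∘ suc)

    poly-snoc : ∀ {d} (u : Vector M.Carrier d) x → poly (ι ∘ snoc u) x ≈ monic (ι ∘ u) x
    poly-snoc {zero}  u x = trans (+-congʳ (trans (*-identityʳ _) 1#-homo)) (+-comm _ _)
    poly-snoc {suc d} u x = trans (poly-∷ (ι ∘ snoc u) x)
      (trans (+-congˡ (*-congˡ (poly-snoc (u ∘ suc) x))) (sym (monic-∷ (ι ∘ u) x)))

  -- If f(0) = 0, then f(x)/x would be a polynomial of smaller degree with root α.
  constantTerm≉0 : ¬ (α ≈ 0#) → ¬ (f zero M.≈ M.0#)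
  constantTerm≉0 α≉0 f₀≈0 = HeytingFields.1≉0 F (M.trans (M.reflexive (≡.sym (snoc-last (f ∘ suc))))
    (f-minimal (snoc (f ∘ suc)) (trans (poly-snoc (f ∘ suc) α) quotient-root) (fromℕ n)))
    where
    quotient-root : monic (ι ∘ f ∘ suc) α ≈ 0#
    quotient-root = HeytingFields.nonzero-cancel heytingField α≉0 (begin
      α * monic (ι ∘ f ∘ suc) α               ≈⟨ +-identityˡ _ ⟨
      0# + α * monic (ι ∘ f ∘ suc) α          ≈⟨ +-congʳ (trans (IsRingHomomorphism.⟦⟧-cong ι-homo f₀≈0) 0#-homo) ⟨
      ι (f zero) + α * monic (ι ∘ f ∘ suc) α  ≈⟨ monic-∷ (ι ∘ f) α ⟨
      monic (ι ∘ f) α                         ≈⟨ f-root ⟩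
      0#                                      ∎)

-- Bounds on integral coordinates, and a lower bound for integral elements

module IntegralCoordinates {c ℓ₁ ℓ₂ : Level} {m : ℕ} (R : CompleteOrderedField) (M : NumberField c ℓ₁ ℓ₂ m)
                           (B : IntegralBasis M) (Σ : Embeddings R M)
                           (S⁻¹ : Matrix (RealOps.ℂ.Carrier R) m m)
                           (inverse : RealOps.ℂ.IsInverse R (embeddingMatrix B Σ) S⁻¹) where
  open RealOps R
  open Reals R
  open Complexes R
  private
    module R = CompleteOrderedField R
    module M = NumberField M
    module C = CommutativeRing complexRing
    ring≈ : CommutativeRing c ℓ₁
    ring≈ = commutativeRingOf M.heytingField
    module CSum = SemiringSum C.semiring
  open IntegralBasis B
  open Embeddings Σ
  open IntegerPolynomials.Solver (commutativeRingOf heytingField) using (solve; _:*_; _:=_)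

  c₂ : Carrier
  c₂ = rowNorm S⁻¹

  c₂-nonNeg : 0# ≤ c₂
  c₂-nonNeg = maximum-nonNeg (λ i → sum (λ j → ∣ S⁻¹ i j ∣))

  size-nonNeg : ∀ γ → 0# ≤ size γ
  size-nonNeg γ = maximum-nonNeg (λ j → ∣ σ j γ ∣)

  ∣σ∣≤size : ∀ j γ → ∣ σ j γ ∣ ≤ size γ
  ∣σ∣≤size j γ = ≤maximum (λ j → ∣ σ j γ ∣) j

  module σ (j : Fin m) where
    open IsRingHomomorphism (σ-homo j) public using (⟦⟧-cong; *-homo; -‿homo)
    open Homomorphism ring≈ complexRing (σ j) (σ-homo j) public

  σ-combination : ∀ j x → σ j (combination x) ℂ.≈ ℂ.sum (λ k → ℂ.fromℤ (x k) ℂ.* σ j (ω k))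
  σ-combination j x = C.trans (σ.sum-homo j (λ k → M.fromℤ (x k) M.* ω k))
    (CSum.sum-cong-≋ {m} (λ k → C.trans (σ.*-homo j _ _) (C.*-congʳ (σ.fromℤ-homo j (x k)))))

  -- The vector of conjugates of γ is S applied to the coordinates, so row i of S⁻¹ recovers the
  -- i-th coordinate after exchanging the two sums.
  coordinate : ∀ {γ} x → γ M.≈ combination x → ∀ i →
               ℂ.fromℤ (x i) ℂ.≈ ℂ.sum (λ j → S⁻¹ i j ℂ.* σ j γ)
  coordinate {γ} x γ≈ i = C.sym (begin
    ℂ.sum (λ j → S⁻¹ i j ℂ.* σ j γ)
      ≈⟨ CSum.sum-cong-≋ {m} (λ j → C.*-congˡ (C.trans (σ.⟦⟧-cong j γ≈) (σ-combination j x))) ⟩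
    ℂ.sum (λ j → S⁻¹ i j ℂ.* ℂ.sum (λ k → ℂ.fromℤ (x k) ℂ.* σ j (ω k)))
      ≈⟨ CSum.sum-cong-≋ {m} (λ j → CSum.*-distribˡ-sum (S⁻¹ i j) (λ k → ℂ.fromℤ (x k) ℂ.* σ j (ω k))) ⟩
    ℂ.sum (λ j → ℂ.sum (λ k → S⁻¹ i j ℂ.* (ℂ.fromℤ (x k) ℂ.* σ j (ω k))))
      ≈⟨ CSum.∑-comm (λ j k → S⁻¹ i j ℂ.* (ℂ.fromℤ (x k) ℂ.* σ j (ω k))) ⟩
    ℂ.sum (λ k → ℂ.sum (λ j → S⁻¹ i j ℂ.* (ℂ.fromℤ (x k) ℂ.* σ j (ω k))))
      ≈⟨ CSum.sum-cong-≋ {m} (λ k → C.trans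
           (CSum.sum-cong-≋ {m} (λ j → C.trans (C.*-congˡ (C.*-comm (ℂ.fromℤ (x k)) (σ j (ω k))))
             (C.sym (C.*-assoc (S⁻¹ i j) (σ j (ω k)) (ℂ.fromℤ (x k))))))
           (C.sym (CSum.*-distribʳ-sum (ℂ.fromℤ (x k)) (λ j → S⁻¹ i j ℂ.* σ j (ω k))))) ⟩
    ℂ.sum (λ k → (S⁻¹ ℂ.*ᴹ embeddingMatrix B Σ) i k ℂ.* ℂ.fromℤ (x k))
      ≈⟨ CSum.sum-cong-≋ {m} (λ k → C.*-congʳ (proj₂ inverse i k)) ⟩
    ℂ.sum (λ k → ℂ.1ᴹ i k ℂ.* ℂ.fromℤ (x k))
      ≈⟨ IdentityMatrix.sum-1ᴹʳ complexRing i (ℂ.fromℤ ∘ x) ⟩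
    ℂ.fromℤ (x i) ∎)
    where open SetoidReasoning C.setoid

  coordinate-bound : ∀ {γ} x → γ M.≈ combination x → ∀ i → ℤ.∣ x i ∣ · 1# ≤ c₂ * size γ
  coordinate-bound {γ} x γ≈ i = ≤-respˡ (trans (∣∣-cong (C.sym (coordinate x γ≈ i))) (∣fromℤ∣ (x i)))
    (≤-trans (∣∑∣≤∑∣∣ (λ j → S⁻¹ i j ℂ.* σ j γ))
    (≤-trans (sum-mono-≤ {m} (λ j → ≤-respˡ (sym (∣zw∣≈∣z∣∣w∣ (S⁻¹ i j) (σ j γ)))
                                  (*-monoʳ-≤ ∣ S⁻¹ i j ∣-nonNeg (∣σ∣≤size j γ))))
    (≤-respˡ (SemiringSum.*-distribʳ-sum semiring (size γ) (λ j → ∣ S⁻¹ i j ∣))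
      (*-monoˡ-≤ (size-nonNeg γ) (≤maximum (λ i → sum (λ j → ∣ S⁻¹ i j ∣)) i)))))

  ⊔·1-lub : ∀ {b} m n → m · 1# ≤ b → n · 1# ≤ b → (m ℕ.⊔ n) · 1# ≤ b
  ⊔·1-lub m n m≤b n≤b with ℕ.⊔-sel m n
  ... | inj₁ e rewrite e = m≤b
  ... | inj₂ e rewrite e = n≤b

  height-bound : ∀ {d b} (x : Vector ℤ d) → 0# ≤ b → (∀ i → ℤ.∣ x i ∣ · 1# ≤ b) → height x · 1# ≤ b
  height-bound {zero}  x 0≤b x≤b = 0≤b
  height-bound {suc d} x 0≤b x≤b = ⊔·1-lub ℤ.∣ x zero ∣ (height (x ∘ suc)) (x≤b zero)
    (height-bound (x ∘ suc) 0≤b (x≤b ∘ suc))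

  -- The source of discreteness: some integer coordinate of γ is nonzero, hence of absolute value at
  -- least 1, while all of them are bounded by c₂ times the size.
  1≤c₂*size : ∀ {γ} → M.IsIntegral γ → ¬ (γ M.≈ M.0#) → 1# ≤ c₂ * size γ
  1≤c₂*size {γ} γ-integral γ≉0 with ω-spans γ γ-integral
  ... | x , γ≈ with all? (λ i → x i ℤ.≟ ℤ.0ℤ)
  ... | yes x≡0 = contradiction (M.trans γ≈ (Determinants.sum-zero ring≈ {v = λ i → M.fromℤ (x i) M.* ω i} (λ i →
          M.trans (M.*-congʳ (M.reflexive (≡.cong M.fromℤ (x≡0 i)))) (M.zeroˡ (ω i))))) γ≉0
  ... | no x≢0 with ¬∀⟶∃¬ m (λ i → x i ≡ ℤ.0ℤ) (λ i → x i ℤ.≟ ℤ.0ℤ) x≢0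
  ...   | i , xᵢ≢0 = ≤-trans
    (≤-respˡ (+-identityʳ 1#) (·1-mono-≤ (ℕ.n≢0⇒n>0 (xᵢ≢0 ∘ ℤ.∣i∣≡0⇒i≡0))))
    (coordinate-bound x γ≈ i)

  -- The k-th iterate δ has conjugates bounded by `b k`, the 2ᵏ-th power of a, and 2ᵏ `b k` ≤ 1.
  -- Multiplying 1 ≤ c₂ |δ| by 2ᵏ yields 2ᵏ ≤ c₂ for every k, which is absurd.
  conjugates-not-small : ∀ {γ} → M.IsIntegral γ → ¬ (γ M.≈ M.0#) →
                         ∀ {a} → 0# ≤ a → two * a ≤ 1# → ¬ (∀ j → ∣ σ j γ ∣ ≤ a)
  conjugates-not-small {γ} γ-integral γ≉0 {a} 0≤a 2a≤1 small = two^-unbounded c₂ λ k → ≤-trans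
    (≤-respˡ (*-identityʳ (two ^ k)) (*-monoʳ-≤ (^-nonNeg k 0≤two) (≤-trans (1≤c₂*size (δ-integral k) (δ≉0 k))
      (*-monoʳ-≤ c₂-nonNeg (maximum-lub (b-nonNeg k) (λ j → δ-small k j))))))
    (≤-respˡ (solve 3 (λ c p b → c :* (p :* b) := p :* (c :* b)) refl c₂ (two ^ k) (b k))
      (≤-respʳ (*-identityʳ c₂) (*-monoʳ-≤ c₂-nonNeg (2ᵏb≤1 k))))
    where
    δ : ℕ → M.Carrier
    δ zero    = γ
    δ (suc k) = M.- (δ k M.* δ k)

    b : ℕ → Carrier
    b zero    = a
    b (suc k) = b k * b k

    δ-integral : ∀ k → M.IsIntegral (δ k)
    δ-integral zero    = γ-integral
    δ-integral (suc k) = IntegerPolynomials.negSquare-integral ring≈ (δ-integral k)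

    δ≉0 : ∀ k → ¬ (δ k M.≈ M.0#)
    δ≉0 zero    = γ≉0
    δ≉0 (suc k) e = δ≉0 k (HeytingFields.nonzero-cancel M.heytingField (δ≉0 k) (M.trans
      (M.sym (-‿involutive (δ k M.* δ k))) (M.trans (M.-‿cong e) -0#≈0#)))
      where open RingProperties M.ring using (-‿involutive; -0#≈0#)

    b-nonNeg : ∀ k → 0# ≤ b k
    b-nonNeg zero    = 0≤a
    b-nonNeg (suc k) = square-nonNeg (b k)

    δ-small : ∀ k j → ∣ σ j (δ k) ∣ ≤ b k
    δ-small zero    j = small j
    δ-small (suc k) j = ≤-respˡ (sym (trans
        (∣∣-cong (C.trans (σ.-‿homo j _) (C.-‿cong (σ.*-homo j (δ k) (δ k)))))
        (trans (∣-z∣≈∣z∣ (σ j (δ k) ℂ.* σ j (δ k))) (∣zw∣≈∣z∣∣w∣ (σ j (δ k)) (σ j (δ k))))))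
      (*-mono-≤ ∣ σ j (δ k) ∣-nonNeg (b-nonNeg k) (δ-small k j) (δ-small k j))

    2b≤1 : ∀ k → two * b k ≤ 1#
    2b≤1 zero    = 2a≤1
    2b≤1 (suc k) = ≤-respˡ (*-assoc two (b k) (b k)) (≤-respʳ (*-identityʳ 1#)
      (*-mono-≤ (b-nonNeg k) 0≤1 (2b≤1 k) (≤-trans (≤-respˡ (*-identityˡ (b k)) (*-monoˡ-≤ (b-nonNeg k) 1≤two)) (2b≤1 k))))

    2ᵏb≤1 : ∀ k → two ^ k * b k ≤ 1#
    2ᵏb≤1 zero    = ≤-trans (*-monoˡ-≤ (b-nonNeg 0) 1≤two) (2b≤1 0)
    -- Regrouped as (2ᵏ b) (2 b), with both factors at most 1.
    2ᵏb≤1 (suc k) = ≤-respˡ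
      (solve 3 (λ t p b → (p :* b) :* (t :* b) := t :* p :* (b :* b)) refl two (two ^ k) (b k))
      (≤-respʳ (*-identityʳ 1#) (*-mono-≤ (R.*-nonNeg 0≤two (b-nonNeg k)) 0≤1 (2ᵏb≤1 k) (2b≤1 k)))

-- Relative conjugates, and the bound on the size of X

module RelativeConjugates {c ℓ₁ ℓ₂ c′ ℓ₁′ ℓ₂′ : Level} {m n : ℕ}
                          {R : CompleteOrderedField} {M : NumberField c ℓ₁ ℓ₂ m} {Σ : Embeddings R M}
                          {L : SimpleExtension (NumberField.heytingField M) c′ ℓ₁′ ℓ₂′ (suc n)}
                          (C : Conjugates Σ L) where
  open RealOps R
  open Reals R
  open Complexes R
  private
    module R = CompleteOrderedField R
    module M = NumberField M
    module K = SimpleExtension L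
    module C = CommutativeRing complexRing
    ring≈ : CommutativeRing c ℓ₁
    ring≈ = commutativeRingOf M.heytingField
  open Embeddings Σ
  open Conjugates C
  open Determinants (commutativeRingOf heytingField) using (product-constant)

  sizeα-nonNeg : 0# ≤ sizeα
  sizeα-nonNeg = maximum-nonNeg (λ j → maximum (λ k → ∣ conjugate j k ∣))

  ∣conjugate∣≤sizeα : ∀ j k → ∣ conjugate j k ∣ ≤ sizeα
  ∣conjugate∣≤sizeα j k = ≤-trans (≤maximum (λ k → ∣ conjugate j k ∣) k)
    (≤maximum (λ j → maximum (λ k → ∣ conjugate j k ∣)) j)

  -- Evaluating the factorization at 0 exhibits the conjugate of the constant term as the product of
  -- the negated conjugates of α.
  ∣constantTerm∣ : ∀ j → ∣ σ j (K.f zero) ∣ ≤ sizeα ^ suc n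
  ∣constantTerm∣ j = ≤-respˡ (trans (sym (∣∏∣≈∏∣∣ (λ k → ℂ.0# ℂ.+ (ℂ.- conjugate j k)))) (∣∣-cong (C.sym product≈)))
    (≤-respʳ (product-constant (suc n) sizeα)
      (product-mono-≤ {suc n} (λ k → ∣ ℂ.0# ℂ.+ (ℂ.- conjugate j k) ∣-nonNeg)
        (λ k → ≤-respˡ (sym (trans (∣∣-cong (C.+-identityˡ (ℂ.- conjugate j k))) (∣-z∣≈∣z∣ (conjugate j k))))
          (∣conjugate∣≤sizeα j k))))
    where
    product≈ : σ j (K.f zero) ℂ.≈ ℂ.product (λ k → ℂ.0# ℂ.+ (ℂ.- conjugate j k))
    product≈ = C.trans (C.sym (C.trans (IntegerPolynomials.monic-∷ complexRing (λ i → σ j (K.f i)) ℂ.0#)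
      (C.trans (C.+-congˡ (C.zeroˡ (ℂ.monic (λ i → σ j (K.f (suc i))) ℂ.0#))) (C.+-identityʳ _)))) (factors j ℂ.0#)

  -- The homogeneous form involves only elements of M, so `σ j` passes through it without being
  -- extended to K.
  σ-norm : ∀ X Y j → σ j (K.norm (K.ι X K.- K.α K.* K.ι Y)) ℂ.≈
                     ℂ.product (λ k → σ j X ℂ.+ (ℂ.- (conjugate j k ℂ.* σ j Y)))
  σ-norm X Y j = C.trans (IsRingHomomorphism.⟦⟧-cong (σ-homo j) (Extension.norm-linear M.heytingField L X Y))
    (C.trans (Homomorphism.homogenize-homo ring≈ complexRing (σ j) (σ-homo j) K.f X Y)
      (homogenize-factors (λ i → σ j (K.f i)) (conjugate j) (factors j) (σ j X) (σ j Y)))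

  size-bound : ∀ {X Y μ} → K.norm (K.ι X K.- K.α K.* K.ι Y) M.≈ μ → ¬ (sizeα ≈ 0#) →
               (root (suc n) (size μ) * sizeα ⁻¹) < size Y → size X ≤ two * (sizeα * size Y)
  size-bound {X} {Y} {μ} norm≈μ sizeα≉0 (c₃≤ , c₃≉) = maximum-lub
    (R.*-nonNeg 0≤two T-nonNeg) bound
    where
    T : Carrier
    T = sizeα * size Y
    T-nonNeg : 0# ≤ T
    T-nonNeg = R.*-nonNeg sizeα-nonNeg (maximum-nonNeg (λ j → ∣ σ j Y ∣))

    factor : Fin m → Fin (suc n) → ℂ.Carrier
    factor j k = σ j X ℂ.+ (ℂ.- (conjugate j k ℂ.* σ j Y))

    T≰root : ¬ (T ≤ root (suc n) (size μ))
    -- Dividing T ≤ root by |α| would give |Y| ≤ c₃, against the strict inequality assumed.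
    T≰root T≤ = c₃≉ (antisym c₃≤ (≤-respˡ
      (trans (*-congʳ (*-comm sizeα (size Y))) (trans (*-assoc _ _ _)
        (trans (*-congˡ (*-⁻¹ sizeα≉0)) (*-identityʳ (size Y)))))
      (*-monoˡ-≤ (⁻¹-nonNeg sizeα-nonNeg sizeα≉0) T≤)))

    small-factor : ∀ j → ∃ λ k → ∣ factor j k ∣ ≤ T
    small-factor j with any? (λ k → ∣ factor j k ∣ ≤? T)
    ... | yes found = found
    -- If no factor is at most T, all are at least T, so T to the power `suc n` is at most |μ⁽ʲ⁾|
    -- and hence at most the size of μ. Then T would lie below the root.
    ... | no  none  = contradiction (≤root n T-nonNeg (≤-trans
      (≤-respˡ (product-constant (suc n) T) (product-mono-≤ {suc n} (λ _ → T-nonNeg) large))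
      (≤-respˡ (trans (∣∣-cong (C.trans (C.sym (IsRingHomomorphism.⟦⟧-cong (σ-homo j) norm≈μ)) (σ-norm X Y j)))
                      (∣∏∣≈∏∣∣ (factor j)))
        (≤maximum (λ j → ∣ σ j μ ∣) j)))) T≰root
      where
      large : ∀ k → T ≤ ∣ factor j k ∣
      large k with total T ∣ factor j k ∣
      ... | inj₁ T≤ = T≤
      ... | inj₂ ≤T = contradiction (k , ≤T) none

    bound : ∀ j → ∣ σ j X ∣ ≤ two * T
    bound j with small-factor j
    ... | k , small = ≤-respˡ (∣∣-cong (C.trans
          (C.+-assoc (σ j X) (ℂ.- αY) αY) (C.trans (C.+-congˡ (C.-‿inverseˡ αY)) (C.+-identityʳ (σ j X)))))
        (≤-trans (∣z+w∣≤∣z∣+∣w∣ (factor j k) αY)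
        (≤-respʳ (sym (trans (distribʳ T 1# 1#) (+-cong (*-identityˡ T) (*-identityˡ T))))
        (+-mono-≤ small (≤-respˡ (sym (∣zw∣≈∣z∣∣w∣ (conjugate j k) (σ j Y)))
          (*-mono-≤ ∣ σ j Y ∣-nonNeg sizeα-nonNeg (∣conjugate∣≤sizeα j k) (≤maximum (λ j → ∣ σ j Y ∣) j))))))
      where
      αY : ℂ.Carrier
      αY = conjugate j k ℂ.* σ j Y

theorem1 : ∀ {c ℓ₁ ℓ₂ c′ ℓ₁′ ℓ₂′} {m n : ℕ}
    (R : CompleteOrderedField)
    (M : NumberField c ℓ₁ ℓ₂ m)
    (B : IntegralBasis M)
    (Σ : Embeddings R M)
    (L : SimpleExtension (NumberField.heytingField M) c′ ℓ₁′ ℓ₂′ n)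
    (C : Conjugates Σ L) →
    let module R = RealOps R
        module M = NumberField M
        module K = SimpleExtension L
        open IntegralBasis B using (combination)
        open Embeddings Σ using (size)
        open Conjugates C using (sizeα)
    in
    K.IsIntegral K.α →
    (∀ i → M.IsIntegral (K.f i)) →
    ¬ (K.α K.≈ K.0#) →
    (μ : M.Carrier) → M.IsIntegral μ → ¬ (μ M.≈ M.0#) →
    (S⁻¹ : Matrix R.ℂ.Carrier m m) → R.ℂ.IsInverse (embeddingMatrix B Σ) S⁻¹ →
    let c₂ = R.rowNorm S⁻¹
        c₃ = R.root n (size μ) R.* (sizeα R.⁻¹)
        c₅ = ((R.1# R.+ R.1#) R.* c₂) R.* sizeα
    in
    (X Y : M.Carrier) → M.IsIntegral X → M.IsIntegral Y →
    K.norm (K.ι X K.- K.α K.* K.ι Y) M.≈ μ →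
    c₃ R.< size Y →
    (x y : Vector ℤ m) → X M.≈ combination x → Y M.≈ combination y →
    let A = height x ℕ.⊔ height y
    in
    (A R.· R.1#) R.≤ (c₅ R.* size Y)
-- In degree 0 the monic polynomial is the constant 1, so `f-root` says 1 = 0 in K.
theorem1 {n = zero} R M B Σ L C _ _ _ _ _ _ _ _ _ _ _ _ _ _ _ _ _ _ =
  contradiction (K.trans (K.sym (K.+-identityˡ K.1#)) K.f-root) (HeytingFields.1≉0 K.heytingField)
  where module K = SimpleExtension L
theorem1 {n = suc n} R M B Σ L C _ f-integral α≉0 μ _ _ S⁻¹ inverse X Y _ _ norm≈μ c₃< x y X≈ Y≈ =
  ⊔·1-lub (height x) (height y)
    (height-bound x c₅Y-nonNeg λ i → ≤-trans (coordinate-bound x X≈ i)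
      (≤-respʳ (solve 4 (λ t c a s → c :* (t :* (a :* s)) := t :* c :* a :* s) refl two c₂ sizeα (size Y))
        (*-monoʳ-≤ c₂-nonNeg (size-bound norm≈μ sizeα≉0 c₃<))))
    (height-bound y c₅Y-nonNeg λ i → ≤-trans (coordinate-bound y Y≈ i)
      (≤-respʳ (solve 4 (λ t c a s → (t :* a) :* (c :* s) := t :* c :* a :* s) refl two c₂ sizeα (size Y))
        (≤-respˡ (*-identityˡ (c₂ * size Y))
          (*-monoˡ-≤ (CompleteOrderedField.*-nonNeg R c₂-nonNeg (size-nonNeg Y)) 1≤2a))))
  where
  open RealOps R
  open Reals R
  open IntegerPolynomials.Solver (commutativeRingOf heytingField) using (solve; _:*_; _:=_)
  open Embeddings Σ using (size)
  open Conjugates C using (sizeα)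
  open IntegralCoordinates R M B Σ S⁻¹ inverse
  open RelativeConjugates C

  c₅Y-nonNeg : 0# ≤ two * c₂ * sizeα * size Y
  c₅Y-nonNeg = *-nonNeg (*-nonNeg (*-nonNeg 0≤two c₂-nonNeg) sizeα-nonNeg) (size-nonNeg Y)
    where open CompleteOrderedField R using (*-nonNeg)

  1≤2a : 1# ≤ two * sizeα
  1≤2a with total 1# (two * sizeα)
  ... | inj₁ 1≤2a = 1≤2a
  -- Since |α| ≤ 1 here, the bound on the constant term, |α| to the power `suc n`, weakens to |α|
  -- itself, for which 2|α| ≤ 1 is at hand.
  ... | inj₂ 2a≤1 = contradiction (λ j → ≤-trans (∣constantTerm∣ j)
      (≤-respʳ (*-identityʳ sizeα) (*-monoʳ-≤ sizeα-nonNeg (^≤1 n sizeα-nonNeg a≤1))))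
    (conjugates-not-small (f-integral zero) (Extension.constantTerm≉0 (NumberField.heytingField M) L α≉0) sizeα-nonNeg 2a≤1)
    where
    a≤1 : sizeα ≤ 1#
    a≤1 = ≤-trans (≤-respˡ (*-identityˡ sizeα) (*-monoˡ-≤ sizeα-nonNeg 1≤two)) 2a≤1

  -- Ensures that the inverse in c₃ is a true inverse and not the default value 0.
  sizeα≉0 : ¬ (sizeα ≈ 0#)
  sizeα≉0 a≈0 = 1≰0 (≤-respʳ (trans (*-congˡ a≈0) (zeroʳ two)) 1≤2a)
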